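{- Let $T$ be a theory (a set of sentences of the language of arithmetic). If $T$ is a consistent extension of Robinson arithmetic $Q$ and the set $\mathcal{Pr}_T$ of Gödel numbers of sentences provable in $T$ is definable in the standard model $\omega$, then the sentence $\psi(n,t)$ is true in $\omega$, but $T\not\vdash\psi(n,t)$. Here the formula $\psi(v_0,v_1)$, the closed term $t$ and the number $n$ are those constructed from $T$ in the context.
   Context: **Language and basic notions.** Fix a standard first-order language of arithmetic (with equality, constant $0$, unary function symbol $s$, binary function symbols $+,\cdot$, order $\le$ primitive or defined; $x<y$ means $x\le y\wedge x\ne y$). Formulas, sentences and terms are those of this language; the variables $v_0,v_1,v_2,\dots$ each count as one primitive symbol, and apart from the variables there are only finitely many primitive symbols. Terms are written with infix $\cdot$ and parentheses. A theory is an arbitrary set of sentences. $Q$ is Robinson arithmetic, with axioms $s(x)\neq 0$; $s(x)=s(y)\to x=y$; $x\ne0\to\exists y\,(x=s(y))$; $x+0=x$; $x+s(y)=s(x+y)$; $x\cdot 0=0$; $x\cdot s(y)=x\cdot y+x$; $x\le y\leftrightarrow\exists z\,(z+x=y)$. An extension of $Q$ is a theory proving all axioms of $Q$. $\omega$ denotes the standard model (and the set of natural numbers); "true" and "definable" mean true and definable in $\omega$. For $i\in\omega$, $\underline{i}$ is the numeral $s\cdots s0$ ($i$ occurrences of $s$); $i$ is written for $\underline i$ inside formulas. Fix a standard Gödel numbering; $\ulcorner\mu\urcorner$ is the Gödel number of $\mu$. A theory is recursively axiomatizable if it has the same theorems as some theory whose set of Gödel numbers is recursive. A formula is $\Sigma_1$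 if it is of the form $(\exists v_i)\mu$ with $\mu$ a $\Delta_0$ (bounded) formula. **Length and naming.** $|e|$ is the number of symbol occurrences in a term or formula $e$ (its length). A formula $\mu$ names the number $i$ if $\mu=\mu(v_0)$ has at most the free variable $v_0$ and $T\vdash(\forall v_0)(\mu(v_0)\leftrightarrow v_0=i)$. **The relation $\mathcal B$ and the formulas $\varphi,\psi$.** Fix a recursive function $g$ such that for every formula $\mu$ and number $j$: if all variables of $\mu$ are among the first $j$ variables $v_0,\dots,v_{j-1}$ and $|\mu|<j$, then $\ulcorner\mu\urcorner<g(j)$ (such a $g$ exists). Let $$\mathcal B=\{(i,j)\in\omega^2:\ \text{there is a formula }\mu\text{ with }\ulcorner\mu\urcorner<g(j),\ |\mu|<j,\text{ and }\mu\text{ names }i\}.$$ If $\mathcal{Pr}_T$ is definable, then so is $\mathcal B$. Let $\varphi(v_0,v_1)$ be a formula with at most the free variables $v_0,v_1$ defining $\mathcal B$, chosen to be $\Sigma_1$ whenever $T$ is recursively axiomatizable (with bound variables such that the substitution below is free). Let $$\psi(v_0,v_1):=\neg\varphi(v_0,v_1)\wedge(\forall v_2<v_0)\,\varphi(v_2,v_1).$$ **The term $t$ and the number $n$.** Let $k_1=|\psi(v_0,v_1)|$, let $k_2$ be any natural number greater than the number of free occurrences of $v_1$ in $\psi(v_0,v_1)$, let $k=k_1k_2$, and let $t$ be the closed term $\underline{10}\cdot(\underline{k}\cdot\underline{k})$, with value $\mathbf t=10k^2$. If $T$ is a consistent extension of $Q$, only finitely many numbers can be named by formulas of length less than $\mathbf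 t$; $n$ is the least number that cannot be named by a formula of length less than $\mathbf t$. -}

module Defs where

open import Data.Bool using (if_then_else_)
open import Data.Fin using (Fin)
open import Data.List using (List; []; _∷_; _++_; length; map; foldr)
open import Data.List.Membership.Propositional using (_∈_; _∉_)
open import Data.List.Relation.Binary.Subset.Propositional using (_⊆_)
open import Data.List.Relation.Unary.All using (All)
open import Data.Nat using (ℕ; zero; suc; _+_; _*_; _^_; _≤_; _<_; _≟_)
open import Data.Product using (Σ; ∃; ∃-syntax; _×_; _,_)
open import Data.Sum using (_⊎_)
open import Data.Unit using (⊤)
open import Data.Vec using (Vec; []; _∷_; lookup)
open import Function.Bundles using (_⇔_)
open import Relation.Binary.PropositionalEquality using (_≡_; _≢_)
open import Relation.Nullary using (¬_; does)

-- Variables are named (not de Bruijn), so that lengths, bounds on the variable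
-- indices and the side conditions on substitution are the usual ones.

Var : Set
Var = ℕ

infixl 26 _⊕_
infixl 27 _⊗_
infix  24 _≐_ _≼_ _≺_
infix  25 ~_
infixr 23 _∧'_
infixr 22 _∨'_
infixr 21 _⇒_
infix  20 _⇔'_

data Term : Set where
  var     : Var → Term
  zer     : Term
  s       : Term → Term
  _⊕_ _⊗_ : Term → Term → Term

data Formula : Set where
  _≐_ _≼_        : Term → Term → Formula
  ~_             : Formula → Formula
  _∧'_ _∨'_ _⇒_  : Formula → Formula → Formula
  ∀' ∃'          : Var → Formula → Formula

_≺_ : Term → Term → Formula
t ≺ u = (t ≼ u) ∧' (~ (t ≐ u))

_⇔'_ : Formula → Formula → Formula
A ⇔' B = (A ⇒ B) ∧' (B ⇒ A)

∀≤ ∃≤ ∀< ∃< : Var → Term → Formula → Formula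
∀≤ x t A = ∀' x ((var x ≼ t) ⇒ A)
∃≤ x t A = ∃' x ((var x ≼ t) ∧' A)
∀< x t A = ∀' x ((var x ≺ t) ⇒ A)
∃< x t A = ∃' x ((var x ≺ t) ∧' A)

num : ℕ → Term
num zero    = zer
num (suc i) = s (num i)

data Symbol : Set where
  𝟎 𝐬 plus times leq eq neg and or imp all ex lpar rpar : Symbol
  v : Var → Symbol

termSymbols : Term → List Symbol
termSymbols (var x) = v x ∷ []
termSymbols zer     = 𝟎 ∷ []
termSymbols (s t)   = 𝐬 ∷ termSymbols t
termSymbols (t ⊕ u) = lpar ∷ termSymbols t ++ plus  ∷ termSymbols u ++ rpar ∷ []
termSymbols (t ⊗ u) = lpar ∷ termSymbols t ++ times ∷ termSymbols u ++ rpar ∷ []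

-- Compound terms and formulas are fully parenthesized, and quantifiers are
-- written (∀vᵢ)A and (∃vᵢ)A.
symbols : Formula → List Symbol
symbols (t ≐ u)  = termSymbols t ++ eq  ∷ termSymbols u
symbols (t ≼ u)  = termSymbols t ++ leq ∷ termSymbols u
symbols (~ A)    = neg ∷ symbols A
symbols (A ∧' B) = lpar ∷ symbols A ++ and ∷ symbols B ++ rpar ∷ []
symbols (A ∨' B) = lpar ∷ symbols A ++ or  ∷ symbols B ++ rpar ∷ []
symbols (A ⇒ B)  = lpar ∷ symbols A ++ imp ∷ symbols B ++ rpar ∷ []
symbols (∀' x A) = lpar ∷ all ∷ v x ∷ rpar ∷ symbols A
symbols (∃' x A) = lpar ∷ ex  ∷ v x ∷ rpar ∷ symbols A

∣_∣ : Formula → ℕ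
∣ A ∣ = length (symbols A)

symbolCode : Symbol → ℕ
symbolCode 𝟎     = 0
symbolCode 𝐬     = 1
symbolCode plus  = 2
symbolCode times = 3
symbolCode leq   = 4
symbolCode eq    = 5
symbolCode neg   = 6
symbolCode and   = 7
symbolCode or    = 8
symbolCode imp   = 9
symbolCode all   = 10
symbolCode ex    = 11
symbolCode lpar  = 12
symbolCode rpar  = 13
symbolCode (v x) = 14 + x

-- A bijection from finite sequences to ℕ:
-- [] ↦ 0  and  a ∷ as ↦ 2ᵃ (2 · code as + 1).
sequenceCode : List ℕ → ℕ
sequenceCode = foldr (λ a c → 2 ^ a * suc (2 * c)) 0

⌜_⌝ : Formula → ℕ
⌜ A ⌝ = sequenceCode (map symbolCode (symbols A))

occ : Var → Term → ℕ
occ x (var y) = if does (x ≟ y) then 1 else 0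
occ x zer     = 0
occ x (s t)   = occ x t
occ x (t ⊕ u) = occ x t + occ x u
occ x (t ⊗ u) = occ x t + occ x u

freeOcc : Var → Formula → ℕ
freeOcc x (t ≐ u)  = occ x t + occ x u
freeOcc x (t ≼ u)  = occ x t + occ x u
freeOcc x (~ A)    = freeOcc x A
freeOcc x (A ∧' B) = freeOcc x A + freeOcc x B
freeOcc x (A ∨' B) = freeOcc x A + freeOcc x B
freeOcc x (A ⇒ B)  = freeOcc x A + freeOcc x B
freeOcc x (∀' y A) = if does (x ≟ y) then 0 else freeOcc x A
freeOcc x (∃' y A) = if does (x ≟ y) then 0 else freeOcc x A

infix 10 _NotIn_ _NotFreeIn_

_NotIn_ : Var → Term → Set
x NotIn t = occ x t ≡ 0

_NotFreeIn_ : Var → Formula → Set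
x NotFreeIn A = freeOcc x A ≡ 0

AtMostFree : List Var → Formula → Set
AtMostFree xs A = ∀ x → x ∉ xs → x NotFreeIn A

Sentence : Formula → Set
Sentence = AtMostFree []

infix 30 _[_/_]ₜ _[_/_]

_[_/_]ₜ : Term → Term → Var → Term
var y   [ t / x ]ₜ = if does (x ≟ y) then t else var y
zer     [ t / x ]ₜ = zer
s u     [ t / x ]ₜ = s (u [ t / x ]ₜ)
(u ⊕ w) [ t / x ]ₜ = (u [ t / x ]ₜ) ⊕ (w [ t / x ]ₜ)
(u ⊗ w) [ t / x ]ₜ = (u [ t / x ]ₜ) ⊗ (w [ t / x ]ₜ)

-- A [ t / x ] replaces the free occurrences of x by t without renaming bound
-- variables; it is meaningful only under FreeFor t x A.
_[_/_] : Formula → Term → Var → Formula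
(u ≐ w)  [ t / x ] = (u [ t / x ]ₜ) ≐ (w [ t / x ]ₜ)
(u ≼ w)  [ t / x ] = (u [ t / x ]ₜ) ≼ (w [ t / x ]ₜ)
(~ A)    [ t / x ] = ~ (A [ t / x ])
(A ∧' B) [ t / x ] = (A [ t / x ]) ∧' (B [ t / x ])
(A ∨' B) [ t / x ] = (A [ t / x ]) ∨' (B [ t / x ])
(A ⇒ B)  [ t / x ] = (A [ t / x ]) ⇒ (B [ t / x ])
(∀' y A) [ t / x ] = if does (x ≟ y) then ∀' y A else ∀' y (A [ t / x ])
(∃' y A) [ t / x ] = if does (x ≟ y) then ∃' y A else ∃' y (A [ t / x ])

FreeFor : Term → Var → Formula → Set
FreeFor t x (u ≐ w)  = ⊤
FreeFor t x (u ≼ w)  = ⊤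
FreeFor t x (~ A)    = FreeFor t x A
FreeFor t x (A ∧' B) = FreeFor t x A × FreeFor t x B
FreeFor t x (A ∨' B) = FreeFor t x A × FreeFor t x B
FreeFor t x (A ⇒ B)  = FreeFor t x A × FreeFor t x B
FreeFor t x (∀' y A) = x NotFreeIn (∀' y A) ⊎ (y NotIn t × FreeFor t x A)
FreeFor t x (∃' y A) = x NotFreeIn (∃' y A) ⊎ (y NotIn t × FreeFor t x A)

record Theory : Set₁ where
  field
    Axiom  : Formula → Set
    closed : ∀ {A} → Axiom A → Sentence A

open Theory public

infix 4 _⨾_⊢_ _⊢_

-- Classical natural deduction with named variables; weaken is a rule because,
-- with eigenvariable conditions on Γ, its admissibility needs renaming.
data _⨾_⊢_ (T : Theory) : List Formula → Formula → Set where
  axiom  : ∀ {Γ A} → Axiom T A → T ⨾ Γ ⊢ A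
  hyp    : ∀ {Γ A} → A ∈ Γ → T ⨾ Γ ⊢ A
  weaken : ∀ {Γ Δ A} → Γ ⊆ Δ → T ⨾ Γ ⊢ A → T ⨾ Δ ⊢ A

  ∧I  : ∀ {Γ A B} → T ⨾ Γ ⊢ A → T ⨾ Γ ⊢ B → T ⨾ Γ ⊢ A ∧' B
  ∧E₁ : ∀ {Γ A B} → T ⨾ Γ ⊢ A ∧' B → T ⨾ Γ ⊢ A
  ∧E₂ : ∀ {Γ A B} → T ⨾ Γ ⊢ A ∧' B → T ⨾ Γ ⊢ B
  ∨I₁ : ∀ {Γ A B} → T ⨾ Γ ⊢ A → T ⨾ Γ ⊢ A ∨' B
  ∨I₂ : ∀ {Γ A B} → T ⨾ Γ ⊢ B → T ⨾ Γ ⊢ A ∨' B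
  ∨E  : ∀ {Γ A B C} → T ⨾ Γ ⊢ A ∨' B →
        T ⨾ A ∷ Γ ⊢ C → T ⨾ B ∷ Γ ⊢ C → T ⨾ Γ ⊢ C
  ⇒I  : ∀ {Γ A B} → T ⨾ A ∷ Γ ⊢ B → T ⨾ Γ ⊢ A ⇒ B
  ⇒E  : ∀ {Γ A B} → T ⨾ Γ ⊢ A ⇒ B → T ⨾ Γ ⊢ A → T ⨾ Γ ⊢ B
  ~I  : ∀ {Γ A B} → T ⨾ A ∷ Γ ⊢ B → T ⨾ A ∷ Γ ⊢ ~ B → T ⨾ Γ ⊢ ~ A
  ~~E : ∀ {Γ A} → T ⨾ Γ ⊢ ~ (~ A) → T ⨾ Γ ⊢ A

  ∀I : ∀ {Γ A} x → All (x NotFreeIn_) Γ → T ⨾ Γ ⊢ A → T ⨾ Γ ⊢ ∀' x A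
  ∀E : ∀ {Γ A x} t → FreeFor t x A → T ⨾ Γ ⊢ ∀' x A → T ⨾ Γ ⊢ A [ t / x ]
  ∃I : ∀ {Γ A x} t → FreeFor t x A → T ⨾ Γ ⊢ A [ t / x ] → T ⨾ Γ ⊢ ∃' x A
  ∃E : ∀ {Γ A x C} → All (x NotFreeIn_) Γ → x NotFreeIn C →
       T ⨾ Γ ⊢ ∃' x A → T ⨾ A ∷ Γ ⊢ C → T ⨾ Γ ⊢ C

  ≐I : ∀ {Γ} t → T ⨾ Γ ⊢ t ≐ t
  ≐E : ∀ {Γ t u} A x → FreeFor t x A → FreeFor u x A →
       T ⨾ Γ ⊢ t ≐ u → T ⨾ Γ ⊢ A [ t / x ] → T ⨾ Γ ⊢ A [ u / x ]

_⊢_ : Theory → Formula → Set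
T ⊢ A = T ⨾ [] ⊢ A

Consistent : Theory → Set
Consistent T = ¬ (∃[ A ] ((T ⊢ A) × (T ⊢ ~ A)))

Q-axioms : List Formula
Q-axioms =
    ∀' 0 (~ (s x ≐ zer))
  ∷ ∀' 0 (∀' 1 (s x ≐ s y ⇒ x ≐ y))
  ∷ ∀' 0 (~ (x ≐ zer) ⇒ ∃' 1 (x ≐ s y))
  ∷ ∀' 0 (x ⊕ zer ≐ x)
  ∷ ∀' 0 (∀' 1 (x ⊕ s y ≐ s (x ⊕ y)))
  ∷ ∀' 0 (x ⊗ zer ≐ zer)
  ∷ ∀' 0 (∀' 1 (x ⊗ s y ≐ x ⊗ y ⊕ x))
  ∷ ∀' 0 (∀' 1 (x ≼ y ⇔' ∃' 2 (z ⊕ x ≐ y)))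
  ∷ []
  where
  x y z : Term
  x = var 0
  y = var 1
  z = var 2

ExtendsQ : Theory → Set
ExtendsQ T = All (T ⊢_) Q-axioms

Assignment : Set
Assignment = Var → ℕ

_[_↦_] : Assignment → Var → ℕ → Assignment
(ρ [ x ↦ a ]) y = if does (x ≟ y) then a else ρ y

⟦_⟧ : Term → Assignment → ℕ
⟦ var x ⟧ ρ = ρ x
⟦ zer ⟧   ρ = 0
⟦ s t ⟧   ρ = suc (⟦ t ⟧ ρ)
⟦ t ⊕ u ⟧ ρ = ⟦ t ⟧ ρ + ⟦ u ⟧ ρ
⟦ t ⊗ u ⟧ ρ = ⟦ t ⟧ ρ * ⟦ u ⟧ ρ

infix 4 _⊨_ ω⊨_

_⊨_ : Assignment → Formula → Set
ρ ⊨ t ≐ u    = ⟦ t ⟧ ρ ≡ ⟦ u ⟧ ρ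
ρ ⊨ t ≼ u    = ⟦ t ⟧ ρ ≤ ⟦ u ⟧ ρ
ρ ⊨ ~ A      = ¬ (ρ ⊨ A)
ρ ⊨ A ∧' B   = (ρ ⊨ A) × (ρ ⊨ B)
ρ ⊨ A ∨' B   = (ρ ⊨ A) ⊎ (ρ ⊨ B)
ρ ⊨ A ⇒ B    = (ρ ⊨ A) → (ρ ⊨ B)
ρ ⊨ ∀' x A   = ∀ a → (ρ [ x ↦ a ]) ⊨ A
ρ ⊨ ∃' x A   = ∃[ a ] ((ρ [ x ↦ a ]) ⊨ A)

ω⊨_ : Formula → Set
ω⊨ A = ∀ ρ → ρ ⊨ A

Defines₁ : Formula → (ℕ → Set) → Set
Defines₁ A P = AtMostFree (0 ∷ []) A × (∀ ρ → (ρ ⊨ A) ⇔ P (ρ 0))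

Defines₂ : Formula → (ℕ → ℕ → Set) → Set
Defines₂ A R = AtMostFree (0 ∷ 1 ∷ []) A × (∀ ρ → (ρ ⊨ A) ⇔ R (ρ 0) (ρ 1))

Definable : (ℕ → Set) → Set
Definable P = ∃[ A ] Defines₁ A P

Pr : Theory → ℕ → Set
Pr T m = ∃[ A ] (Sentence A × (T ⊢ A) × ⌜ A ⌝ ≡ m)

data Δ₀ : Formula → Set where
  Δ₀-≐  : ∀ {t u} → Δ₀ (t ≐ u)
  Δ₀-≼  : ∀ {t u} → Δ₀ (t ≼ u)
  Δ₀-~  : ∀ {A} → Δ₀ A → Δ₀ (~ A)
  Δ₀-∧  : ∀ {A B} → Δ₀ A → Δ₀ B → Δ₀ (A ∧' B)
  Δ₀-∨  : ∀ {A B} → Δ₀ A → Δ₀ B → Δ₀ (A ∨' B)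
  Δ₀-⇒  : ∀ {A B} → Δ₀ A → Δ₀ B → Δ₀ (A ⇒ B)
  Δ₀-∀≤ : ∀ {x t A} → x NotIn t → Δ₀ A → Δ₀ (∀≤ x t A)
  Δ₀-∃≤ : ∀ {x t A} → x NotIn t → Δ₀ A → Δ₀ (∃≤ x t A)
  Δ₀-∀< : ∀ {x t A} → x NotIn t → Δ₀ A → Δ₀ (∀< x t A)
  Δ₀-∃< : ∀ {x t A} → x NotIn t → Δ₀ A → Δ₀ (∃< x t A)

Σ₁ : Formula → Set
Σ₁ A = ∃[ x ] ∃[ B ] (A ≡ ∃' x B × Δ₀ B)

data Rec : ℕ → Set where
  zeroʳ : ∀ {n} → Rec n
  sucʳ  : Rec 1
  proj  : ∀ {n} → Fin n → Rec n
  comp  : ∀ {m n} → Rec m → (Fin m → Rec n) → Rec n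
  prec  : ∀ {n} → Rec n → Rec (2 + n) → Rec (suc n)
  μ     : ∀ {n} → Rec (suc n) → Rec n

infix 4 _·_⇓_

-- f · as ⇓ b : the partial recursive function f has value b at as.
data _·_⇓_ : ∀ {n} → Rec n → Vec ℕ n → ℕ → Set where
  ⇓zero : ∀ {n} {as : Vec ℕ n} → zeroʳ · as ⇓ 0
  ⇓suc  : ∀ {a} → sucʳ · a ∷ [] ⇓ suc a
  ⇓proj : ∀ {n} {as : Vec ℕ n} i → proj i · as ⇓ lookup as i
  ⇓comp : ∀ {m n} {f : Rec m} {gs : Fin m → Rec n} {as : Vec ℕ n} {c} bs →
          (∀ i → gs i · as ⇓ lookup bs i) → f · bs ⇓ c → comp f gs · as ⇓ c
  ⇓prec-zero : ∀ {n} {f : Rec n} {h : Rec (2 + n)} {as : Vec ℕ n} {c} →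
          f · as ⇓ c → prec f h · 0 ∷ as ⇓ c
  ⇓prec-suc  : ∀ {n} {f : Rec n} {h : Rec (2 + n)} {as : Vec ℕ n} {a b c} →
          prec f h · a ∷ as ⇓ b → h · a ∷ b ∷ as ⇓ c → prec f h · suc a ∷ as ⇓ c
  ⇓μ    : ∀ {n} {f : Rec (suc n)} {as : Vec ℕ n} {b} → f · b ∷ as ⇓ 0 →
          (∀ a → a < b → ∃[ c ] (f · a ∷ as ⇓ suc c)) → μ f · as ⇓ b

Recursive : (ℕ → ℕ) → Set
Recursive f = Σ (Rec 1) λ e → ∀ a → e · a ∷ [] ⇓ f a

RecursiveSet : (ℕ → Set) → Set
RecursiveSet P = ∃[ χ ] (Recursive χ ×
  (∀ a → (P a × χ a ≡ 1) ⊎ (¬ P a × χ a ≡ 0)))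

RecursivelyAxiomatizable : Theory → Set₁
RecursivelyAxiomatizable T = Σ Theory λ T' →
  (∀ A → Sentence A → (T ⊢ A) ⇔ (T' ⊢ A)) ×
  RecursiveSet (λ m → ∃[ A ] (Axiom T' A × ⌜ A ⌝ ≡ m))

Names : Theory → Formula → ℕ → Set
Names T A i = AtMostFree (0 ∷ []) A × (T ⊢ ∀' 0 (A ⇔' var 0 ≐ num i))

NameableBelow : Theory → ℕ → ℕ → Set
NameableBelow T ℓ i = ∃[ A ] (∣ A ∣ < ℓ × Names T A i)

VarsBelow : ℕ → Formula → Set
VarsBelow j A = ∀ x → v x ∈ symbols A → x < j

BoundsCodes : (ℕ → ℕ) → Set
BoundsCodes g = ∀ A j → VarsBelow j A → ∣ A ∣ < j → ⌜ A ⌝ < g j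

𝓑 : Theory → (ℕ → ℕ) → ℕ → ℕ → Set
𝓑 T g i j = ∃[ A ] (⌜ A ⌝ < g j × ∣ A ∣ < j × Names T A i)

ψ : Formula → Formula
ψ φ = (~ φ) ∧' ∀< 2 (var 0) (φ [ var 2 / 0 ])

kOf : Formula → ℕ → ℕ
kOf φ k₂ = ∣ ψ φ ∣ * k₂

tTerm : ℕ → Term
tTerm k = num 10 ⊗ (num k ⊗ num k)

tValue : ℕ → ℕ
tValue k = 10 * (k * k)

infix 30 _⟨_,_⟩

-- For closed t and u this is the simultaneous substitution A(t, u).
_⟨_,_⟩ : Formula → Term → Term → Formula
A ⟨ t , u ⟩ = (A [ t / 0 ]) [ u / 1 ]

{-# OPTIONS --safe #-}

-- If T proved ψ(n,t), the formula ψ(v₀,t) would name n in T: v₀ is provably one of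
-- 0, …, n - 1 or at least n; T refutes ψ(i,t) for i < n because it proves φ(i,t), and
-- ψ(v₀,t) with v₀ above n gives φ(n,t), which T refutes.  Since t has length 2k + 19,
-- the length of ψ(v₀,t) is below 10k², contradicting the choice of n.
--
-- For the truth of ψ(n,t), a name of length < j has to be turned into one using only
-- v₀, …, v_{j-1}.  Fewer than j symbols leave one of these variables unused, and the
-- highest variable, which is bound, is replaced by it; this is repeated downwards.
module Submission where

open import Defs
open import Data.Bool using (Bool; true; false; if_then_else_)
open import Data.Empty using (⊥-elim)
open import Data.Fin using (Fin; toℕ)
open import Data.Fin.Properties using (¬∀⟶∃¬; pigeonhole; toℕ<n)
open import Data.List using (List; []; _∷_; _++_; length; map; lookup)
open import Data.List.Properties using (map-++; length-map; length-++)
open import Data.List.Membership.Propositional using (_∈_; _∉_)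
open import Data.List.Membership.Propositional.Properties using (∈-++⁺ˡ; ∈-++⁺ʳ; ∈-map⁻)
open import Data.List.Relation.Unary.All as All using ([]; _∷_)
open import Data.List.Relation.Unary.Any using (here; there; index; any?)
open import Data.List.Relation.Unary.Any.Properties using (lookup-index)
open import Data.Nat
  using (ℕ; zero; suc; _+_; _*_; _∸_; _⊔_; _≤_; _<_; s≤s; z≤n; _≡ᵇ_; _≟_; >-nonZero)
open import Data.Nat.Properties
  using (+-identityʳ; +-monoʳ-<; +-monoʳ-≤; +-mono-≤; +-suc; *-monoˡ-<; *-monoˡ-≤; *-monoʳ-≤;
    m+n≡0⇒m≡0; m+n≡0⇒n≡0; ≡ᵇ⇒≡; ≡⇒≡ᵇ; <-irrefl; <-≤-trans; ≤-<-trans; ≤-trans; ≤-refl;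
    ≤-reflexive; m≤m+n; m≤n+m; m<n+m; ≤∧≢⇒<; ≤-pred; n<1+n; n≤1+n; <⇒≤; <⇒≢; m<n⇒n≢0; m<n⇒m<1+n;
    m⊔n≤o⇒m≤o; m⊔n≤o⇒n≤o; m+[n∸m]≡n; m≤m*n; m≤n*m; module ≤-Reasoning)
open import Data.Nat.Tactic.RingSolver using (solve-∀)
open import Data.Product using (∃; ∃-syntax; _×_; _,_)
open import Data.Product.Function.NonDependent.Propositional using (_×-⇔_)
open import Data.Sum using (_⊎_; inj₁; inj₂)
open import Data.Sum.Function.Propositional using (_⊎-⇔_)
open import Data.Unit using (tt)
open import Function.Bundles using (_⇔_; mk⇔; Equivalence)
open import Function.Construct.Composition using (_⇔-∘_)
open import Function.Construct.Identity using (⇔-id)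
open import Function.Related.TypeIsomorphisms using (¬-cong-⇔; →-cong-⇔)
open import Relation.Binary.PropositionalEquality
  using (_≡_; _≢_; refl; sym; trans; cong; cong₂; subst; subst₂)
open import Relation.Nullary using (¬_; Dec; yes; no)

-- The obstacle to truth is the code bound: `𝓑` admits a name only if its code is below `g j`, and
-- `BoundsCodes` gives this only for formulas in v₀, ..., v_{j-1}, whereas `NameableBelow` restricts
-- the length alone. Since the calculus has named variables and no rule for renaming bound ones, the
-- new name must come with derivations in `T` both ways, hence an interderivability relation that is
-- a congruence.
--
-- For unprovability, `Q` has no induction and does not prove its order linear. The comparison of v₀
-- with n is therefore an induction outside `T` that peels off one numeral at a time. The parameter
-- t is substituted beforehand, so that this argument concerns a formula in v₀ only.
--
-- The factor k₂ makes k exceed the number of occurrences of v₁, and the factor k₁ makes it at least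
-- |ψ|. The length of t is linear in k while its value is quadratic. The coefficient 10 is 2 + 8:
-- replacing v₁ costs about 2k², and 8k² absorbs the linear rest.

open Equivalence using (to; from)

-- Substitution and free variables

-- does (x ≟ y) reduces to x ≡ᵇ y, so case distinctions have to abstract the latter.
data EqView (x y : ℕ) : Bool → Set where
  same : x ≡ y → EqView x y true
  diff : x ≢ y → EqView x y false

eqView : ∀ x y → EqView x y (x ≡ᵇ y)
eqView x y with x ≡ᵇ y | ≡ᵇ⇒≡ x y | ≡⇒≡ᵇ x y
... | true  | f | _ = same (f tt)
... | false | _ | g = diff g

Closed : Term → Set
Closed u = ∀ x → x NotIn u

num-closed : ∀ i → Closed (num i)
num-closed zero    x = refl
num-closed (suc i) x = num-closed i x

+≡0 : ∀ {m n} → m ≡ 0 → n ≡ 0 → m + n ≡ 0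
+≡0 refl refl = refl

+≡0ˡ : ∀ {m n} → m + n ≡ 0 → m ≡ 0
+≡0ˡ {m} = m+n≡0⇒m≡0 m

+≡0ʳ : ∀ {m n} → m + n ≡ 0 → n ≡ 0
+≡0ʳ {m} = m+n≡0⇒n≡0 m

≢⇒notIn-var : ∀ {x y} → x ≢ y → x NotIn var y
≢⇒notIn-var {x} {y} x≢y with x ≡ᵇ y | eqView x y
... | _ | same x≡y = ⊥-elim (x≢y x≡y)
... | _ | diff _    = refl

notIn-var⇒≢ : ∀ {x y} → x NotIn var y → x ≢ y
notIn-var⇒≢ {x} {y} p with x ≡ᵇ y | eqView x y
notIn-var⇒≢ () | _ | same _
... | _ | diff x≢y = x≢y

notFree-∀ : ∀ x A → x NotFreeIn ∀' x A
notFree-∀ x A with x ≡ᵇ x | eqView x x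
... | _ | same _  = refl
... | _ | diff x≢x = ⊥-elim (x≢x refl)

notFree-∃ : ∀ x A → x NotFreeIn ∃' x A
notFree-∃ = notFree-∀

notFree-∀⁺ : ∀ {x A} y → x NotFreeIn A → x NotFreeIn ∀' y A
notFree-∀⁺ {x} y p with x ≡ᵇ y | eqView x y
... | _ | same _ = refl
... | _ | diff _  = p

notFree-∀-≢ : ∀ {x y A} → x ≢ y → freeOcc x (∀' y A) ≡ freeOcc x A
notFree-∀-≢ {x} {y} x≢y with x ≡ᵇ y | eqView x y
... | _ | same x≡y = ⊥-elim (x≢y x≡y)
... | _ | diff _   = refl

substₜ-var : ∀ x {u} → var x [ u / x ]ₜ ≡ u
substₜ-var x with x ≡ᵇ x | eqView x x
... | _ | same _  = refl
... | _ | diff x≢x = ⊥-elim (x≢x refl)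

substₜ-notIn : ∀ {x u} a → x NotIn a → a [ u / x ]ₜ ≡ a
substₜ-notIn {x} (var y) p with x ≡ᵇ y | eqView x y
substₜ-notIn (var y) () | _ | same _
... | _ | diff _ = refl
substₜ-notIn zer     p = refl
substₜ-notIn (s a)   p = cong s (substₜ-notIn a p)
substₜ-notIn (a ⊕ b) p = cong₂ _⊕_ (substₜ-notIn a (+≡0ˡ p)) (substₜ-notIn b (+≡0ʳ {occ _ a} p))
substₜ-notIn (a ⊗ b) p = cong₂ _⊗_ (substₜ-notIn a (+≡0ˡ p)) (substₜ-notIn b (+≡0ʳ {occ _ a} p))

subst-notFree : ∀ {x u} A → x NotFreeIn A → A [ u / x ] ≡ A
subst-notFree (a ≐ b)  p = cong₂ _≐_ (substₜ-notIn a (+≡0ˡ p)) (substₜ-notIn b (+≡0ʳ {occ _ a} p))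
subst-notFree (a ≼ b)  p = cong₂ _≼_ (substₜ-notIn a (+≡0ˡ p)) (substₜ-notIn b (+≡0ʳ {occ _ a} p))
subst-notFree (~ A)    p = cong ~_ (subst-notFree A p)
subst-notFree (A ∧' B) p = cong₂ _∧'_ (subst-notFree A (+≡0ˡ p)) (subst-notFree B (+≡0ʳ {freeOcc _ A} p))
subst-notFree (A ∨' B) p = cong₂ _∨'_ (subst-notFree A (+≡0ˡ p)) (subst-notFree B (+≡0ʳ {freeOcc _ A} p))
subst-notFree (A ⇒ B)  p = cong₂ _⇒_ (subst-notFree A (+≡0ˡ p)) (subst-notFree B (+≡0ʳ {freeOcc _ A} p))
subst-notFree {x} (∀' y A) p with x ≡ᵇ y | eqView x y
... | _ | same _ = refl
... | _ | diff _  = cong (∀' y) (subst-notFree A p)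
subst-notFree {x} (∃' y A) p with x ≡ᵇ y | eqView x y
... | _ | same _ = refl
... | _ | diff _  = cong (∃' y) (subst-notFree A p)

substₜ-self : ∀ x a → a [ var x / x ]ₜ ≡ a
substₜ-self x (var y) with x ≡ᵇ y | eqView x y
... | _ | same refl = refl
... | _ | diff _     = refl
substₜ-self x zer     = refl
substₜ-self x (s a)   = cong s (substₜ-self x a)
substₜ-self x (a ⊕ b) = cong₂ _⊕_ (substₜ-self x a) (substₜ-self x b)
substₜ-self x (a ⊗ b) = cong₂ _⊗_ (substₜ-self x a) (substₜ-self x b)

subst-self : ∀ x A → A [ var x / x ] ≡ A
subst-self x (a ≐ b)  = cong₂ _≐_ (substₜ-self x a) (substₜ-self x b)
subst-self x (a ≼ b)  = cong₂ _≼_ (substₜ-self x a) (substₜ-self x b)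
subst-self x (~ A)    = cong ~_ (subst-self x A)
subst-self x (A ∧' B) = cong₂ _∧'_ (subst-self x A) (subst-self x B)
subst-self x (A ∨' B) = cong₂ _∨'_ (subst-self x A) (subst-self x B)
subst-self x (A ⇒ B)  = cong₂ _⇒_ (subst-self x A) (subst-self x B)
subst-self x (∀' y A) with x ≡ᵇ y | eqView x y
... | _ | same _ = refl
... | _ | diff _  = cong (∀' y) (subst-self x A)
subst-self x (∃' y A) with x ≡ᵇ y | eqView x y
... | _ | same _ = refl
... | _ | diff _  = cong (∃' y) (subst-self x A)

freeFor-closed : ∀ {u x} A → Closed u → FreeFor u x A
freeFor-closed (a ≐ b)  c = tt
freeFor-closed (a ≼ b)  c = tt
freeFor-closed (~ A)    c = freeFor-closed A c
freeFor-closed (A ∧' B) c = freeFor-closed A c , freeFor-closed B c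
freeFor-closed (A ∨' B) c = freeFor-closed A c , freeFor-closed B c
freeFor-closed (A ⇒ B)  c = freeFor-closed A c , freeFor-closed B c
freeFor-closed (∀' y A) c = inj₂ (c y , freeFor-closed A c)
freeFor-closed (∃' y A) c = inj₂ (c y , freeFor-closed A c)

freeFor-self : ∀ x A → FreeFor (var x) x A
freeFor-self x (a ≐ b)  = tt
freeFor-self x (a ≼ b)  = tt
freeFor-self x (~ A)    = freeFor-self x A
freeFor-self x (A ∧' B) = freeFor-self x A , freeFor-self x B
freeFor-self x (A ∨' B) = freeFor-self x A , freeFor-self x B
freeFor-self x (A ⇒ B)  = freeFor-self x A , freeFor-self x B
freeFor-self x (∀' y A) with x ≡ᵇ y | eqView x y
... | _ | same _  = inj₁ refl
... | _ | diff x≢y = inj₂ (≢⇒notIn-var (λ y≡x → x≢y (sym y≡x)) , freeFor-self x A)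
freeFor-self x (∃' y A) with x ≡ᵇ y | eqView x y
... | _ | same _  = inj₁ refl
... | _ | diff x≢y = inj₂ (≢⇒notIn-var (λ y≡x → x≢y (sym y≡x)) , freeFor-self x A)

substₜ-comm : ∀ {x y u w} → x ≢ y → y NotIn u → x NotIn w → ∀ a →
              a [ u / x ]ₜ [ w / y ]ₜ ≡ a [ w / y ]ₜ [ u / x ]ₜ
substₜ-comm {x} {y} {u} {w} x≢y p q (var z) with x ≡ᵇ z | eqView x z | y ≡ᵇ z | eqView y z
... | _ | same refl | _ | same refl = ⊥-elim (x≢y refl)
... | _ | same refl | _ | diff _     = trans (substₜ-notIn u p) (sym (substₜ-var x))
... | _ | diff _     | _ | same refl = trans (substₜ-var y) (sym (substₜ-notIn w q))
... | _ | diff x≢z   | _ | diff y≢z   =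
  trans (substₜ-notIn {y} (var z) (≢⇒notIn-var {y} y≢z))
        (sym (substₜ-notIn {x} (var z) (≢⇒notIn-var {x} x≢z)))
substₜ-comm x≢y p q zer     = refl
substₜ-comm x≢y p q (s a)   = cong s (substₜ-comm x≢y p q a)
substₜ-comm x≢y p q (a ⊕ b) = cong₂ _⊕_ (substₜ-comm x≢y p q a) (substₜ-comm x≢y p q b)
substₜ-comm x≢y p q (a ⊗ b) = cong₂ _⊗_ (substₜ-comm x≢y p q a) (substₜ-comm x≢y p q b)

subst-∀-≢ : ∀ {x y u A} → x ≢ y → (∀' y A) [ u / x ] ≡ ∀' y (A [ u / x ])
subst-∀-≢ {x} {y} x≢y with x ≡ᵇ y | eqView x y
... | _ | same x≡y = ⊥-elim (x≢y x≡y)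
... | _ | diff _    = refl

subst-∃-≢ : ∀ {x y u A} → x ≢ y → (∃' y A) [ u / x ] ≡ ∃' y (A [ u / x ])
subst-∃-≢ {x} {y} x≢y with x ≡ᵇ y | eqView x y
... | _ | same x≡y = ⊥-elim (x≢y x≡y)
... | _ | diff _    = refl

subst-∀-≡ : ∀ {u A} x → (∀' x A) [ u / x ] ≡ ∀' x A
subst-∀-≡ {A = A} x = subst-notFree (∀' x A) (notFree-∀ x A)

subst-∃-≡ : ∀ {u A} x → (∃' x A) [ u / x ] ≡ ∃' x A
subst-∃-≡ {A = A} x = subst-notFree (∃' x A) (notFree-∃ x A)

subst-comm : ∀ {x y u w} → x ≢ y → y NotIn u → x NotIn w → ∀ A →
             A [ u / x ] [ w / y ] ≡ A [ w / y ] [ u / x ]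
subst-comm x≢y p q (a ≐ b)  = cong₂ _≐_ (substₜ-comm x≢y p q a) (substₜ-comm x≢y p q b)
subst-comm x≢y p q (a ≼ b)  = cong₂ _≼_ (substₜ-comm x≢y p q a) (substₜ-comm x≢y p q b)
subst-comm x≢y p q (~ A)    = cong ~_ (subst-comm x≢y p q A)
subst-comm x≢y p q (A ∧' B) = cong₂ _∧'_ (subst-comm x≢y p q A) (subst-comm x≢y p q B)
subst-comm x≢y p q (A ∨' B) = cong₂ _∨'_ (subst-comm x≢y p q A) (subst-comm x≢y p q B)
subst-comm x≢y p q (A ⇒ B)  = cong₂ _⇒_ (subst-comm x≢y p q A) (subst-comm x≢y p q B)
subst-comm {x} {y} x≢y p q (∀' z A) with x ≡ᵇ z | eqView x z | y ≡ᵇ z | eqView y z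
... | _ | same refl | _ | same refl = ⊥-elim (x≢y refl)
... | _ | same refl | _ | diff y≢z   = trans (subst-∀-≢ y≢z) (sym (subst-∀-≡ x))
... | _ | diff x≢z   | _ | same refl = trans (subst-∀-≡ y) (sym (subst-∀-≢ x≢z))
... | _ | diff x≢z   | _ | diff y≢z   =
  trans (subst-∀-≢ y≢z) (trans (cong (∀' z) (subst-comm x≢y p q A)) (sym (subst-∀-≢ x≢z)))
subst-comm {x} {y} x≢y p q (∃' z A) with x ≡ᵇ z | eqView x z | y ≡ᵇ z | eqView y z
... | _ | same refl | _ | same refl = ⊥-elim (x≢y refl)
... | _ | same refl | _ | diff y≢z   = trans (subst-∃-≢ y≢z) (sym (subst-∃-≡ x))
... | _ | diff x≢z   | _ | same refl = trans (subst-∃-≡ y) (sym (subst-∃-≢ x≢z))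
... | _ | diff x≢z   | _ | diff y≢z   =
  trans (subst-∃-≢ y≢z) (trans (cong (∃' z) (subst-comm x≢y p q A)) (sym (subst-∃-≢ x≢z)))

substₜ-trans : ∀ {x y w} a → y NotIn a → a [ var y / x ]ₜ [ w / y ]ₜ ≡ a [ w / x ]ₜ
substₜ-trans {x} {y} (var z) p with x ≡ᵇ z | eqView x z
... | _ | same _ = substₜ-var y
... | _ | diff _  = substₜ-notIn {y} (var z) p
substₜ-trans zer     p = refl
substₜ-trans (s a)   p = cong s (substₜ-trans a p)
substₜ-trans (a ⊕ b) p = cong₂ _⊕_ (substₜ-trans a (+≡0ˡ p)) (substₜ-trans b (+≡0ʳ {occ _ a} p))
substₜ-trans (a ⊗ b) p = cong₂ _⊗_ (substₜ-trans a (+≡0ˡ p)) (substₜ-trans b (+≡0ʳ {occ _ a} p))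

subst-trans-notFree : ∀ {x y u w} A → y NotFreeIn A → x NotFreeIn A →
                      A [ u / x ] [ w / y ] ≡ A [ w / x ]
subst-trans-notFree A p q =
  trans (cong _[ _ / _ ] (subst-notFree A q))
        (trans (subst-notFree A p) (sym (subst-notFree A q)))

-- As `y` is not free in `A`, the second substitution meets only the occurrences created by the
-- first, and `FreeFor` ensures that none of these has been captured.
subst-trans : ∀ {x y w} A → y NotFreeIn A → FreeFor (var y) x A →
              A [ var y / x ] [ w / y ] ≡ A [ w / x ]
subst-trans (a ≐ b)  p f = cong₂ _≐_ (substₜ-trans a (+≡0ˡ p)) (substₜ-trans b (+≡0ʳ {occ _ a} p))
subst-trans (a ≼ b)  p f = cong₂ _≼_ (substₜ-trans a (+≡0ˡ p)) (substₜ-trans b (+≡0ʳ {occ _ a} p))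
subst-trans (~ A)    p f = cong ~_ (subst-trans A p f)
subst-trans (A ∧' B) p (f , g) =
  cong₂ _∧'_ (subst-trans A (+≡0ˡ p) f) (subst-trans B (+≡0ʳ {freeOcc _ A} p) g)
subst-trans (A ∨' B) p (f , g) =
  cong₂ _∨'_ (subst-trans A (+≡0ˡ p) f) (subst-trans B (+≡0ʳ {freeOcc _ A} p) g)
subst-trans (A ⇒ B)  p (f , g) =
  cong₂ _⇒_ (subst-trans A (+≡0ˡ p) f) (subst-trans B (+≡0ʳ {freeOcc _ A} p) g)
subst-trans (∀' z A) p (inj₁ q) = subst-trans-notFree (∀' z A) p q
subst-trans {x} {y} (∀' z A) p (inj₂ (z∉y , f)) with x ≡ᵇ z | eqView x z
... | _ | same refl = subst-notFree (∀' x A) p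
... | _ | diff _ with y ≡ᵇ z | eqView y z
...   | _ | same refl = ⊥-elim (notIn-var⇒≢ {y} z∉y refl)
...   | _ | diff _     = cong (∀' z) (subst-trans A p f)
subst-trans (∃' z A) p (inj₁ q) = subst-trans-notFree (∃' z A) p q
subst-trans {x} {y} (∃' z A) p (inj₂ (z∉y , f)) with x ≡ᵇ z | eqView x z
... | _ | same refl = subst-notFree (∃' x A) p
... | _ | diff _ with y ≡ᵇ z | eqView y z
...   | _ | same refl = ⊥-elim (notIn-var⇒≢ {y} z∉y refl)
...   | _ | diff _     = cong (∃' z) (subst-trans A p f)

-- The hypothesis on `a` is conditional because for `z` equal to `x` every old occurrence is
-- replaced.
notIn-substₜ : ∀ {x u z} a → (z ≢ x → z NotIn a) → z NotIn u → z NotIn a [ u / x ]ₜ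
notIn-substₜ {x} {z = z} (var y) p q with x ≡ᵇ y | eqView x y
... | _ | same _  = q
... | _ | diff x≢y =
  ≢⇒notIn-var {z} λ { refl → notIn-var⇒≢ {z} (p (λ y≡x → x≢y (sym y≡x))) refl }
notIn-substₜ zer     p q = refl
notIn-substₜ (s a)   p q = notIn-substₜ a p q
notIn-substₜ (a ⊕ b) p q =
  +≡0 (notIn-substₜ a (λ d → +≡0ˡ (p d)) q) (notIn-substₜ b (λ d → +≡0ʳ {occ _ a} (p d)) q)
notIn-substₜ (a ⊗ b) p q =
  +≡0 (notIn-substₜ a (λ d → +≡0ˡ (p d)) q) (notIn-substₜ b (λ d → +≡0ʳ {occ _ a} (p d)) q)

notFree-subst : ∀ {x u z} A → (z ≢ x → z NotFreeIn A) → z NotIn u → z NotFreeIn A [ u / x ]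
notFree-subst (a ≐ b) p q =
  +≡0 (notIn-substₜ a (λ d → +≡0ˡ (p d)) q) (notIn-substₜ b (λ d → +≡0ʳ {occ _ a} (p d)) q)
notFree-subst (a ≼ b) p q =
  +≡0 (notIn-substₜ a (λ d → +≡0ˡ (p d)) q) (notIn-substₜ b (λ d → +≡0ʳ {occ _ a} (p d)) q)
notFree-subst (~ A)    p q = notFree-subst A p q
notFree-subst (A ∧' B) p q =
  +≡0 (notFree-subst A (λ d → +≡0ˡ (p d)) q) (notFree-subst B (λ d → +≡0ʳ {freeOcc _ A} (p d)) q)
notFree-subst (A ∨' B) p q =
  +≡0 (notFree-subst A (λ d → +≡0ˡ (p d)) q) (notFree-subst B (λ d → +≡0ʳ {freeOcc _ A} (p d)) q)
notFree-subst (A ⇒ B)  p q =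
  +≡0 (notFree-subst A (λ d → +≡0ˡ (p d)) q) (notFree-subst B (λ d → +≡0ʳ {freeOcc _ A} (p d)) q)
notFree-subst {x} {z = z} (∀' y A) p q with z ≡ᵇ y | eqView z y | x ≡ᵇ y | eqView x y
... | _ | same refl | _ | same refl = notFree-∀ x A
... | _ | same refl | _ | diff _     = notFree-∀ z (A [ _ / x ])
... | _ | diff z≢y   | _ | same refl = trans (notFree-∀-≢ {A = A} z≢y) (p z≢y)
... | _ | diff _     | _ | diff _     = notFree-∀⁺ {A = A [ _ / x ]} y (notFree-subst A p q)
notFree-subst {x} {z = z} (∃' y A) p q with z ≡ᵇ y | eqView z y | x ≡ᵇ y | eqView x y
... | _ | same refl | _ | same refl = notFree-∃ x A
... | _ | same refl | _ | diff _     = notFree-∃ z (A [ _ / x ])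
... | _ | diff z≢y   | _ | same refl = trans (notFree-∀-≢ {A = A} z≢y) (p z≢y)
... | _ | diff _     | _ | diff _     = notFree-∀⁺ {A = A [ _ / x ]} y (notFree-subst A p q)

-- Semantics

-- The occurrence count is a parameter, so that terms, formulas and bodies of quantifiers share one
-- relation.
Agree : Assignment → Assignment → (Var → ℕ) → Set
Agree ρ ρ′ m = ∀ x → ρ x ≡ ρ′ x ⊎ m x ≡ 0

agree-⊆ : ∀ {ρ ρ′ m m′} → (∀ x → m x ≡ 0 → m′ x ≡ 0) → Agree ρ ρ′ m → Agree ρ ρ′ m′
agree-⊆ h e x with e x
... | inj₁ p = inj₁ p
... | inj₂ p = inj₂ (h x p)

agree-update : ∀ {ρ ρ′ A} y a → Agree ρ ρ′ (λ x → freeOcc x (∀' y A)) →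
               Agree (ρ [ y ↦ a ]) (ρ′ [ y ↦ a ]) (λ x → freeOcc x A)
agree-update y a e z with y ≡ᵇ z | eqView y z
... | _ | same _ = inj₁ refl
... | _ | diff y≢z with z ≡ᵇ y | eqView z y | e z
...   | _ | same refl | _      = ⊥-elim (y≢z refl)
...   | _ | diff _     | inj₁ p = inj₁ p
...   | _ | diff _     | inj₂ p = inj₂ p

⟦⟧-cong : ∀ {ρ ρ′} a → Agree ρ ρ′ (λ x → occ x a) → ⟦ a ⟧ ρ ≡ ⟦ a ⟧ ρ′
⟦⟧-cong (var x) e with e x
... | inj₁ p = p
... | inj₂ p = ⊥-elim (notIn-var⇒≢ {x} p refl)
⟦⟧-cong zer     e = refl
⟦⟧-cong (s a)   e = cong suc (⟦⟧-cong a e)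
⟦⟧-cong (a ⊕ b) e =
  cong₂ _+_ (⟦⟧-cong a (agree-⊆ (λ x → +≡0ˡ) e)) (⟦⟧-cong b (agree-⊆ (λ x → +≡0ʳ {occ x a}) e))
⟦⟧-cong (a ⊗ b) e =
  cong₂ _*_ (⟦⟧-cong a (agree-⊆ (λ x → +≡0ˡ) e)) (⟦⟧-cong b (agree-⊆ (λ x → +≡0ʳ {occ x a}) e))

≡⇒⇔ : ∀ {A B : Set} → A ≡ B → A ⇔ B
≡⇒⇔ refl = ⇔-id _

∀-cong-⇔ : ∀ {P R : ℕ → Set} → (∀ a → P a ⇔ R a) → (∀ a → P a) ⇔ (∀ a → R a)
∀-cong-⇔ h = mk⇔ (λ f a → to (h a) (f a)) (λ f a → from (h a) (f a))

∃-cong-⇔ : ∀ {P R : ℕ → Set} → (∀ a → P a ⇔ R a) → (∃ P) ⇔ (∃ R)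
∃-cong-⇔ h = mk⇔ (λ (a , p) → a , to (h a) p) (λ (a , p) → a , from (h a) p)

⊨-cong : ∀ {ρ ρ′} A → Agree ρ ρ′ (λ x → freeOcc x A) → (ρ ⊨ A) ⇔ (ρ′ ⊨ A)
⊨-cong (a ≐ b)  e = ≡⇒⇔
  (cong₂ _≡_ (⟦⟧-cong a (agree-⊆ (λ x → +≡0ˡ) e)) (⟦⟧-cong b (agree-⊆ (λ x → +≡0ʳ {occ x a}) e)))
⊨-cong (a ≼ b)  e = ≡⇒⇔
  (cong₂ _≤_ (⟦⟧-cong a (agree-⊆ (λ x → +≡0ˡ) e)) (⟦⟧-cong b (agree-⊆ (λ x → +≡0ʳ {occ x a}) e)))
⊨-cong (~ A)    e = ¬-cong-⇔ (⊨-cong A e)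
⊨-cong (A ∧' B) e =
  ⊨-cong A (agree-⊆ (λ x → +≡0ˡ) e) ×-⇔ ⊨-cong B (agree-⊆ (λ x → +≡0ʳ {freeOcc x A}) e)
⊨-cong (A ∨' B) e =
  ⊨-cong A (agree-⊆ (λ x → +≡0ˡ) e) ⊎-⇔ ⊨-cong B (agree-⊆ (λ x → +≡0ʳ {freeOcc x A}) e)
⊨-cong (A ⇒ B)  e =
  →-cong-⇔ (⊨-cong A (agree-⊆ (λ x → +≡0ˡ) e)) (⊨-cong B (agree-⊆ (λ x → +≡0ʳ {freeOcc x A}) e))
⊨-cong (∀' y A) e = ∀-cong-⇔ (λ a → ⊨-cong A (agree-update {A = A} y a e))
⊨-cong (∃' y A) e = ∃-cong-⇔ (λ a → ⊨-cong A (agree-update {A = A} y a e))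

agree-notIn : ∀ {ρ m} x a → m x ≡ 0 → Agree ρ (ρ [ x ↦ a ]) m
agree-notIn x a p z with x ≡ᵇ z | eqView x z
... | _ | same refl = inj₂ p
... | _ | diff _     = inj₁ refl

⟦⟧-subst : ∀ {ρ x u} a → ⟦ a [ u / x ]ₜ ⟧ ρ ≡ ⟦ a ⟧ (ρ [ x ↦ ⟦ u ⟧ ρ ])
⟦⟧-subst {x = x} (var y) with x ≡ᵇ y | eqView x y
... | _ | same _ = refl
... | _ | diff _  = refl
⟦⟧-subst zer     = refl
⟦⟧-subst (s a)   = cong suc (⟦⟧-subst a)
⟦⟧-subst (a ⊕ b) = cong₂ _+_ (⟦⟧-subst a) (⟦⟧-subst b)
⟦⟧-subst (a ⊗ b) = cong₂ _*_ (⟦⟧-subst a) (⟦⟧-subst b)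

⊨-subst-notFree : ∀ {ρ x u} A → x NotFreeIn A → (ρ ⊨ A [ u / x ]) ⇔ (ρ [ x ↦ ⟦ u ⟧ ρ ] ⊨ A)
⊨-subst-notFree {ρ} {x} {u} A p =
  subst (λ B → (ρ ⊨ B) ⇔ (ρ [ x ↦ ⟦ u ⟧ ρ ] ⊨ A)) (sym (subst-notFree A p))
        (⊨-cong A (agree-notIn x _ p))

-- The two updates commute because `u`, not containing `y`, has the same value before and after the
-- update at `y`.
agree-comm : ∀ {ρ m x y u} a → x ≢ y → y NotIn u →
             Agree (ρ [ y ↦ a ] [ x ↦ ⟦ u ⟧ (ρ [ y ↦ a ]) ]) (ρ [ x ↦ ⟦ u ⟧ ρ ] [ y ↦ a ]) m
agree-comm {x = x} {y} {u} a x≢y p z with x ≡ᵇ z | eqView x z | y ≡ᵇ z | eqView y z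
... | _ | same refl | _ | same refl = ⊥-elim (x≢y refl)
... | _ | same refl | _ | diff _     = inj₁ (sym (⟦⟧-cong u (agree-notIn y a p)))
... | _ | diff _     | _ | same refl = inj₁ refl
... | _ | diff _     | _ | diff _     = inj₁ refl

⊨-subst : ∀ {ρ x u} A → FreeFor u x A → (ρ ⊨ A [ u / x ]) ⇔ (ρ [ x ↦ ⟦ u ⟧ ρ ] ⊨ A)
⊨-subst (a ≐ b)  f = ≡⇒⇔ (cong₂ _≡_ (⟦⟧-subst a) (⟦⟧-subst b))
⊨-subst (a ≼ b)  f = ≡⇒⇔ (cong₂ _≤_ (⟦⟧-subst a) (⟦⟧-subst b))
⊨-subst (~ A)    f = ¬-cong-⇔ (⊨-subst A f)
⊨-subst (A ∧' B) (f , g) = ⊨-subst A f ×-⇔ ⊨-subst B g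
⊨-subst (A ∨' B) (f , g) = ⊨-subst A f ⊎-⇔ ⊨-subst B g
⊨-subst (A ⇒ B)  (f , g) = →-cong-⇔ (⊨-subst A f) (⊨-subst B g)
⊨-subst (∀' y A) (inj₁ p) = ⊨-subst-notFree (∀' y A) p
⊨-subst {ρ} {x} {u} (∀' y A) (inj₂ (q , f)) with x ≡ᵇ y | eqView x y
... | _ | same refl = ⊨-cong (∀' x A) (agree-notIn x (⟦ u ⟧ ρ) (notFree-∀ x A))
... | _ | diff x≢y   = ∀-cong-⇔ (λ a → ⊨-cong A (agree-comm {u = u} a x≢y q) ⇔-∘ ⊨-subst A f)
⊨-subst (∃' y A) (inj₁ p) = ⊨-subst-notFree (∃' y A) p
⊨-subst {ρ} {x} {u} (∃' y A) (inj₂ (q , f)) with x ≡ᵇ y | eqView x y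
... | _ | same refl = ⊨-cong (∃' x A) (agree-notIn x (⟦ u ⟧ ρ) (notFree-∃ x A))
... | _ | diff x≢y   = ∃-cong-⇔ (λ a → ⊨-cong A (agree-comm {u = u} a x≢y q) ⇔-∘ ⊨-subst A f)

⟦num⟧ : ∀ {ρ} i → ⟦ num i ⟧ ρ ≡ i
⟦num⟧ zero    = refl
⟦num⟧ (suc i) = cong suc (⟦num⟧ i)

-- Derived rules

-- Allows a derivation made under the sole hypothesis `A` to be used in any context, whatever
-- variables are free there.
cut : ∀ {T Γ A B} → T ⨾ Γ ⊢ A → T ⨾ A ∷ [] ⊢ B → T ⨾ Γ ⊢ B
cut d e = ⇒E (weaken (λ ()) (⇒I e)) d

hyp₀ : ∀ {T Γ A} → T ⨾ A ∷ Γ ⊢ A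
hyp₀ = hyp (here refl)

hyp₁ : ∀ {T Γ A B} → T ⨾ B ∷ A ∷ Γ ⊢ A
hyp₁ = hyp (there (here refl))

wk : ∀ {T Γ A B} → T ⨾ Γ ⊢ A → T ⨾ B ∷ Γ ⊢ A
wk = weaken there

theorem : ∀ {T Γ A} → T ⊢ A → T ⨾ Γ ⊢ A
theorem = weaken (λ ())

explode : ∀ {T Γ A B} → T ⨾ Γ ⊢ A → T ⨾ Γ ⊢ ~ A → T ⨾ Γ ⊢ B
explode d e = ~~E (~I (wk d) (wk e))

-- Assuming `~ C`, the first premise refutes `A`, so the second yields `C`; double negation
-- elimination finishes.
byCases : ∀ {T Γ C} A → T ⨾ A ∷ Γ ⊢ C → T ⨾ ~ A ∷ Γ ⊢ C → T ⨾ Γ ⊢ C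
byCases {T} {Γ} {C} A d e =
  ~~E (~I {B = C} (⇒E (wk (⇒I e)) not-A) hyp₀)
  where
  not-A : T ⨾ ~ C ∷ Γ ⊢ ~ A
  not-A = ~I (⇒E (wk (wk (⇒I d))) hyp₀) hyp₁

∀E-self : ∀ {T Γ A x} → T ⨾ Γ ⊢ ∀' x A → T ⨾ Γ ⊢ A
∀E-self {T} {Γ} {A} {x} d =
  subst (T ⨾ Γ ⊢_) (subst-self x A) (∀E (var x) (freeFor-self x A) d)

∃I-self : ∀ {T Γ A x} → T ⨾ Γ ⊢ A → T ⨾ Γ ⊢ ∃' x A
∃I-self {T} {Γ} {A} {x} d =
  ∃I (var x) (freeFor-self x A) (subst (T ⨾ Γ ⊢_) (sym (subst-self x A)) d)

-- Renaming of variables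

infix 4 _⟛[_]_

-- Each side is the only hypothesis for the other, so the eigenvariable conditions in the quantifier
-- congruences hold automatically.
_⟛[_]_ : Formula → Theory → Formula → Set
A ⟛[ T ] B = (T ⨾ A ∷ [] ⊢ B) × (T ⨾ B ∷ [] ⊢ A)

⟛-refl : ∀ {T A} → A ⟛[ T ] A
⟛-refl = hyp₀ , hyp₀

⟛-trans : ∀ {T A B C} → A ⟛[ T ] B → B ⟛[ T ] C → A ⟛[ T ] C
⟛-trans (f , f′) (g , g′) = cut f g , cut g′ f′

~-cong : ∀ {T A B} → A ⟛[ T ] B → ~ A ⟛[ T ] ~ B
~-cong (f , f′) = ~I (cut hyp₀ f′) hyp₁ , ~I (cut hyp₀ f) hyp₁

∧-cong : ∀ {T A B C D} → A ⟛[ T ] B → C ⟛[ T ] D → A ∧' C ⟛[ T ] B ∧' D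
∧-cong (f , f′) (g , g′) =
  ∧I (cut (∧E₁ hyp₀) f) (cut (∧E₂ hyp₀) g) , ∧I (cut (∧E₁ hyp₀) f′) (cut (∧E₂ hyp₀) g′)

∨-cong : ∀ {T A B C D} → A ⟛[ T ] B → C ⟛[ T ] D → A ∨' C ⟛[ T ] B ∨' D
∨-cong (f , f′) (g , g′) =
  ∨E hyp₀ (∨I₁ (cut hyp₀ f)) (∨I₂ (cut hyp₀ g)) , ∨E hyp₀ (∨I₁ (cut hyp₀ f′)) (∨I₂ (cut hyp₀ g′))

⇒-cong : ∀ {T A B C D} → A ⟛[ T ] B → C ⟛[ T ] D → A ⇒ C ⟛[ T ] B ⇒ D
⇒-cong (f , f′) (g , g′) =
  ⇒I (cut (⇒E hyp₁ (cut hyp₀ f′)) g) , ⇒I (cut (⇒E hyp₁ (cut hyp₀ f)) g′)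

∀-cong : ∀ {T A B} x → A ⟛[ T ] B → ∀' x A ⟛[ T ] ∀' x B
∀-cong {A = A} {B} x (f , f′) =
  ∀I x (notFree-∀ x A ∷ []) (cut (∀E-self hyp₀) f) ,
  ∀I x (notFree-∀ x B ∷ []) (cut (∀E-self hyp₀) f′)

∃-cong : ∀ {T A B} x → A ⟛[ T ] B → ∃' x A ⟛[ T ] ∃' x B
∃-cong {A = A} {B} x (f , f′) =
  ∃E (notFree-∃ x A ∷ []) (notFree-∃ x B) hyp₀ (∃I-self (cut hyp₀ f)) ,
  ∃E (notFree-∃ x B ∷ []) (notFree-∃ x A) hyp₀ (∃I-self (cut hyp₀ f′))

-- Stronger than `NotFreeIn`: `y` may not be a bound variable either, so putting `y` for another
-- variable cannot lead to capture.
Fresh : Var → Formula → Set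
Fresh y (a ≐ b)  = y NotIn a × y NotIn b
Fresh y (a ≼ b)  = y NotIn a × y NotIn b
Fresh y (~ A)    = Fresh y A
Fresh y (A ∧' B) = Fresh y A × Fresh y B
Fresh y (A ∨' B) = Fresh y A × Fresh y B
Fresh y (A ⇒ B)  = Fresh y A × Fresh y B
Fresh y (∀' z A) = z ≢ y × Fresh y A
Fresh y (∃' z A) = z ≢ y × Fresh y A

fresh⇒notFree : ∀ {y} A → Fresh y A → y NotFreeIn A
fresh⇒notFree (a ≐ b)  (p , q) = +≡0 p q
fresh⇒notFree (a ≼ b)  (p , q) = +≡0 p q
fresh⇒notFree (~ A)    p       = fresh⇒notFree A p
fresh⇒notFree (A ∧' B) (p , q) = +≡0 (fresh⇒notFree A p) (fresh⇒notFree B q)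
fresh⇒notFree (A ∨' B) (p , q) = +≡0 (fresh⇒notFree A p) (fresh⇒notFree B q)
fresh⇒notFree (A ⇒ B)  (p , q) = +≡0 (fresh⇒notFree A p) (fresh⇒notFree B q)
fresh⇒notFree (∀' z A) (_ , p) = notFree-∀⁺ {A = A} z (fresh⇒notFree A p)
fresh⇒notFree (∃' z A) (_ , p) = notFree-∀⁺ {A = A} z (fresh⇒notFree A p)

fresh⇒freeFor : ∀ {x y} A → Fresh y A → FreeFor (var y) x A
fresh⇒freeFor (a ≐ b)  p         = tt
fresh⇒freeFor (a ≼ b)  p         = tt
fresh⇒freeFor (~ A)    p         = fresh⇒freeFor A p
fresh⇒freeFor (A ∧' B) (p , q)   = fresh⇒freeFor A p , fresh⇒freeFor B q
fresh⇒freeFor (A ∨' B) (p , q)   = fresh⇒freeFor A p , fresh⇒freeFor B q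
fresh⇒freeFor (A ⇒ B)  (p , q)   = fresh⇒freeFor A p , fresh⇒freeFor B q
fresh⇒freeFor (∀' z A) (z≢y , p) = inj₂ (≢⇒notIn-var z≢y , fresh⇒freeFor A p)
fresh⇒freeFor (∃' z A) (z≢y , p) = inj₂ (≢⇒notIn-var z≢y , fresh⇒freeFor A p)

-- After y has replaced the free occurrences of x, it lies in the scope of no
-- quantifier over x, so it can be changed back.
fresh⇒freeFor-back : ∀ {x y} A → Fresh y A → FreeFor (var x) y (A [ var y / x ])
fresh⇒freeFor-back (a ≐ b)  p       = tt
fresh⇒freeFor-back (a ≼ b)  p       = tt
fresh⇒freeFor-back (~ A)    p       = fresh⇒freeFor-back A p
fresh⇒freeFor-back (A ∧' B) (p , q) = fresh⇒freeFor-back A p , fresh⇒freeFor-back B q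
fresh⇒freeFor-back (A ∨' B) (p , q) = fresh⇒freeFor-back A p , fresh⇒freeFor-back B q
fresh⇒freeFor-back (A ⇒ B)  (p , q) = fresh⇒freeFor-back A p , fresh⇒freeFor-back B q
fresh⇒freeFor-back {x} {y} (∀' z A) (_ , p) with x ≡ᵇ z | eqView x z
... | _ | same refl = inj₁ (notFree-∀⁺ {A = A} x (fresh⇒notFree A p))
... | _ | diff x≢z  = inj₂ (≢⇒notIn-var (λ z≡x → x≢z (sym z≡x)) , fresh⇒freeFor-back A p)
fresh⇒freeFor-back {x} {y} (∃' z A) (_ , p) with x ≡ᵇ z | eqView x z
... | _ | same refl = inj₁ (notFree-∀⁺ {A = A} x (fresh⇒notFree A p))
... | _ | diff x≢z  = inj₂ (≢⇒notIn-var (λ z≡x → x≢z (sym z≡x)) , fresh⇒freeFor-back A p)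

subst-back : ∀ {x y} A → Fresh y A → A [ var y / x ] [ var x / y ] ≡ A
subst-back {x} A p =
  trans (subst-trans A (fresh⇒notFree A p) (fresh⇒freeFor A p)) (subst-self x A)

-- Serves for `∃'` as well, since `freeOcc` has the same clause for both quantifiers.
notFree-bound-subst : ∀ {x y} A → x NotFreeIn ∀' y (A [ var y / x ])
notFree-bound-subst {x} {y} A with x ≡ᵇ y | eqView x y
... | _ | same _   = refl
... | _ | diff x≢y = notFree-subst A (λ x≢x → ⊥-elim (x≢x refl)) (≢⇒notIn-var x≢y)

∀-α : ∀ {T x y} A → Fresh y A → ∀' x A ⟛[ T ] ∀' y (A [ var y / x ])
∀-α {T} {x} {y} A p =
  ∀I y (notFree-∀⁺ {A = A} x (fresh⇒notFree A p) ∷ []) (∀E (var y) (fresh⇒freeFor A p) hyp₀) ,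
  ∀I x (notFree-bound-subst A ∷ [])
    (subst (T ⨾ ∀' y (A [ var y / x ]) ∷ [] ⊢_) (subst-back A p)
      (∀E (var x) (fresh⇒freeFor-back A p) hyp₀))

∃-α : ∀ {T x y} A → Fresh y A → ∃' x A ⟛[ T ] ∃' y (A [ var y / x ])
∃-α {T} {x} {y} A p =
  ∃E (notFree-∃ x A ∷ []) (notFree-bound-subst A) hyp₀
    (∃I (var x) (fresh⇒freeFor-back A p) (subst (T ⨾ _ ⊢_) (sym (subst-back A p)) hyp₀)) ,
  ∃E (notFree-∃ y (A [ var y / x ]) ∷ []) (notFree-∀⁺ {A = A} x (fresh⇒notFree A p)) hyp₀
    (∃I (var y) (fresh⇒freeFor A p) hyp₀)

replace : Var → Var → Var → Var
replace y x z = if x ≡ᵇ z then y else z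

-- Unlike substitution, this also changes bound occurrences and the quantifier prefixes. It
-- therefore acts on the symbol string letter by letter, keeps its length, and removes `x`
-- altogether when `y` differs from `x`.
rename : Var → Var → Formula → Formula
rename y x (a ≐ b)  = (a [ var y / x ]ₜ) ≐ (b [ var y / x ]ₜ)
rename y x (a ≼ b)  = (a [ var y / x ]ₜ) ≼ (b [ var y / x ]ₜ)
rename y x (~ A)    = ~ rename y x A
rename y x (A ∧' B) = rename y x A ∧' rename y x B
rename y x (A ∨' B) = rename y x A ∨' rename y x B
rename y x (A ⇒ B)  = rename y x A ⇒ rename y x B
rename y x (∀' z A) = ∀' (replace y x z) (rename y x A)
rename y x (∃' z A) = ∃' (replace y x z) (rename y x A)

-- The two sides differ only below quantifiers over `x`, where substitution stops. There a change of
-- bound variable to `y` turns the body into `A [ var y / x ]`, and induction applies.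
rename-α : ∀ {T x y} A → Fresh y A → A [ var y / x ] ⟛[ T ] rename y x A
rename-α (a ≐ b)  p       = ⟛-refl
rename-α (a ≼ b)  p       = ⟛-refl
rename-α (~ A)    p       = ~-cong (rename-α A p)
rename-α (A ∧' B) (p , q) = ∧-cong (rename-α A p) (rename-α B q)
rename-α (A ∨' B) (p , q) = ∨-cong (rename-α A p) (rename-α B q)
rename-α (A ⇒ B)  (p , q) = ⇒-cong (rename-α A p) (rename-α B q)
rename-α {x = x} {y} (∀' z A) (_ , p) with x ≡ᵇ z | eqView x z
... | _ | same refl = ⟛-trans (∀-α A p) (∀-cong y (rename-α A p))
... | _ | diff _    = ∀-cong z (rename-α A p)
rename-α {x = x} {y} (∃' z A) (_ , p) with x ≡ᵇ z | eqView x z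
... | _ | same refl = ⟛-trans (∃-α A p) (∃-cong y (rename-α A p))
... | _ | diff _    = ∃-cong z (rename-α A p)

notFree-rename : ∀ {x y z} A → z NotFreeIn A [ var y / x ] → z NotFreeIn rename y x A
-- The case of a quantifier over `x`, which substitution leaves alone but renaming moves to `y`.
notFree-rename-binder : ∀ {x y z} A → z NotFreeIn ∀' x A → z NotFreeIn ∀' y (rename y x A)

notFree-rename (a ≐ b)  p = p
notFree-rename (a ≼ b)  p = p
notFree-rename (~ A)    p = notFree-rename A p
notFree-rename (A ∧' B) p = +≡0 (notFree-rename A (+≡0ˡ p)) (notFree-rename B (+≡0ʳ {freeOcc _ (A [ _ / _ ])} p))
notFree-rename (A ∨' B) p = +≡0 (notFree-rename A (+≡0ˡ p)) (notFree-rename B (+≡0ʳ {freeOcc _ (A [ _ / _ ])} p))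
notFree-rename (A ⇒ B)  p = +≡0 (notFree-rename A (+≡0ˡ p)) (notFree-rename B (+≡0ʳ {freeOcc _ (A [ _ / _ ])} p))
notFree-rename {x} {y} {z} (∀' w A) p with x ≡ᵇ w | eqView x w
... | _ | same refl = notFree-rename-binder A p
... | _ | diff _ with z ≡ᵇ w
...   | true  = refl
...   | false = notFree-rename A p
notFree-rename {x} {y} {z} (∃' w A) p with x ≡ᵇ w | eqView x w
... | _ | same refl = notFree-rename-binder A p
... | _ | diff _ with z ≡ᵇ w
...   | true  = refl
...   | false = notFree-rename A p

notFree-rename-binder {x} {y} {z} A p with z ≡ᵇ y | eqView z y
... | _ | same _   = refl
... | _ | diff z≢y = notFree-rename A (notFree-subst A
  (λ z≢x → trans (sym (notFree-∀-≢ {A = A} z≢x)) p) (≢⇒notIn-var z≢y))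

-- Symbol strings of renamed formulas

replaceSymbol : Var → Var → Symbol → Symbol
replaceSymbol y x (v z) = v (replace y x z)
replaceSymbol y x σ     = σ

map-infix : ∀ {A B : Set} {f : A → B} {m r as bs as′ bs′} → map f as ≡ as′ → map f bs ≡ bs′ →
            map f (as ++ m ∷ bs ++ r ∷ []) ≡ as′ ++ f m ∷ bs′ ++ f r ∷ []
map-infix {f = f} {m} {r} {as} {bs} refl refl =
  trans (map-++ f as (m ∷ bs ++ r ∷ [])) (cong (λ l → map f as ++ f m ∷ l) (map-++ f bs (r ∷ [])))

map-infix′ : ∀ {A B : Set} {f : A → B} {m as bs as′ bs′} → map f as ≡ as′ → map f bs ≡ bs′ →
             map f (as ++ m ∷ bs) ≡ as′ ++ f m ∷ bs′
map-infix′ {f = f} {m} {as} {bs} refl refl = map-++ f as (m ∷ bs)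

termSymbols-rename : ∀ x y a → map (replaceSymbol y x) (termSymbols a) ≡ termSymbols (a [ var y / x ]ₜ)
termSymbols-rename x y (var z) with x ≡ᵇ z
... | true  = refl
... | false = refl
termSymbols-rename x y zer     = refl
termSymbols-rename x y (s a)   = cong (𝐬 ∷_) (termSymbols-rename x y a)
termSymbols-rename x y (a ⊕ b) =
  cong (lpar ∷_) (map-infix (termSymbols-rename x y a) (termSymbols-rename x y b))
termSymbols-rename x y (a ⊗ b) =
  cong (lpar ∷_) (map-infix (termSymbols-rename x y a) (termSymbols-rename x y b))

symbols-rename : ∀ x y A → map (replaceSymbol y x) (symbols A) ≡ symbols (rename y x A)
symbols-rename x y (a ≐ b)  = map-infix′ (termSymbols-rename x y a) (termSymbols-rename x y b)
symbols-rename x y (a ≼ b)  = map-infix′ (termSymbols-rename x y a) (termSymbols-rename x y b)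
symbols-rename x y (~ A)    = cong (neg ∷_) (symbols-rename x y A)
symbols-rename x y (A ∧' B) = cong (lpar ∷_) (map-infix (symbols-rename x y A) (symbols-rename x y B))
symbols-rename x y (A ∨' B) = cong (lpar ∷_) (map-infix (symbols-rename x y A) (symbols-rename x y B))
symbols-rename x y (A ⇒ B)  = cong (lpar ∷_) (map-infix (symbols-rename x y A) (symbols-rename x y B))
symbols-rename x y (∀' z A) = cong (λ l → lpar ∷ all ∷ v (replace y x z) ∷ rpar ∷ l) (symbols-rename x y A)
symbols-rename x y (∃' z A) = cong (λ l → lpar ∷ ex ∷ v (replace y x z) ∷ rpar ∷ l) (symbols-rename x y A)

length-rename : ∀ x y A → ∣ rename y x A ∣ ≡ ∣ A ∣
length-rename x y A =
  trans (cong length (sym (symbols-rename x y A))) (length-map (replaceSymbol y x) (symbols A))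

-- Only the index `m` has to be excluded anew, and each of its occurrences becomes `y`.
varsBelow-rename : ∀ {m y} A → y < m → VarsBelow (suc m) A → VarsBelow m (rename y m A)
varsBelow-rename {m} {y} A y<m below z z∈
  with ∈-map⁻ (replaceSymbol y m) (subst (v z ∈_) (sym (symbols-rename m y A)) z∈)
... | v w , w∈ , e with m ≡ᵇ w | eqView m w | e
...   | _ | same _   | refl = y<m
...   | _ | diff m≢w | refl = ≤∧≢⇒< (≤-pred (below w w∈)) (λ w≡m → m≢w (sym w≡m))

∉⇒notIn : ∀ {y} a → v y ∉ termSymbols a → y NotIn a
∉⇒notIn {y} (var z) p = ≢⇒notIn-var {y} (λ { refl → p (here refl) })
∉⇒notIn zer     p = refl
∉⇒notIn (s a)   p = ∉⇒notIn a (λ q → p (there q))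
∉⇒notIn (a ⊕ b) p = +≡0
  (∉⇒notIn a (λ q → p (there (∈-++⁺ˡ q))))
  (∉⇒notIn b (λ q → p (there (∈-++⁺ʳ (termSymbols a) (there (∈-++⁺ˡ q))))))
∉⇒notIn (a ⊗ b) p = +≡0
  (∉⇒notIn a (λ q → p (there (∈-++⁺ˡ q))))
  (∉⇒notIn b (λ q → p (there (∈-++⁺ʳ (termSymbols a) (there (∈-++⁺ˡ q))))))

∉⇒fresh : ∀ {y} A → v y ∉ symbols A → Fresh y A
∉⇒fresh (a ≐ b)  p =
  ∉⇒notIn a (λ q → p (∈-++⁺ˡ q)) , ∉⇒notIn b (λ q → p (∈-++⁺ʳ (termSymbols a) (there q)))
∉⇒fresh (a ≼ b)  p =
  ∉⇒notIn a (λ q → p (∈-++⁺ˡ q)) , ∉⇒notIn b (λ q → p (∈-++⁺ʳ (termSymbols a) (there q)))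
∉⇒fresh (~ A)    p = ∉⇒fresh A (λ q → p (there q))
∉⇒fresh (A ∧' B) p =
  ∉⇒fresh A (λ q → p (there (∈-++⁺ˡ q))) ,
  ∉⇒fresh B (λ q → p (there (∈-++⁺ʳ (symbols A) (there (∈-++⁺ˡ q)))))
∉⇒fresh (A ∨' B) p =
  ∉⇒fresh A (λ q → p (there (∈-++⁺ˡ q))) ,
  ∉⇒fresh B (λ q → p (there (∈-++⁺ʳ (symbols A) (there (∈-++⁺ˡ q)))))
∉⇒fresh (A ⇒ B)  p =
  ∉⇒fresh A (λ q → p (there (∈-++⁺ˡ q))) ,
  ∉⇒fresh B (λ q → p (there (∈-++⁺ʳ (symbols A) (there (∈-++⁺ˡ q)))))
∉⇒fresh (∀' z A) p =
  (λ { refl → p (there (there (here refl))) }) , ∉⇒fresh A (λ q → p (there (there (there (there q)))))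
∉⇒fresh (∃' z A) p =
  (λ { refl → p (there (there (here refl))) }) , ∉⇒fresh A (λ q → p (there (there (there (there q)))))

v-injective : ∀ {x y} → v x ≡ v y → x ≡ y
v-injective refl = refl

is-v? : ∀ x σ → Dec (v x ≡ σ)
is-v? x (v y) with x ≟ y
... | yes refl = yes refl
... | no x≢y   = no λ e → x≢y (v-injective e)
is-v? x 𝟎     = no λ ()
is-v? x 𝐬     = no λ ()
is-v? x plus  = no λ ()
is-v? x times = no λ ()
is-v? x leq   = no λ ()
is-v? x eq    = no λ ()
is-v? x neg   = no λ ()
is-v? x and   = no λ ()
is-v? x or    = no λ ()
is-v? x imp   = no λ ()
is-v? x all   = no λ ()
is-v? x ex    = no λ ()
is-v? x lpar  = no λ ()
is-v? x rpar  = no λ ()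

unused-variable : ∀ {j} l → length l < j → ∃[ y ] (y < j × v y ∉ l)
unused-variable {j} l l<j =
  let i , i∉ = ¬∀⟶∃¬ j (λ i → v (toℕ i) ∈ l) (λ i → any? (is-v? (toℕ i)) l) not-all
  in toℕ i , toℕ<n i , i∉
  where
  not-all : ¬ (∀ (i : Fin j) → v (toℕ i) ∈ l)
  not-all h =
    let i , i′ , i<i′ , e = pigeonhole l<j (λ i → index (h i))
    in <⇒≢ i<i′ (v-injective
         (trans (lookup-index (h i)) (trans (cong (lookup l) e) (sym (lookup-index (h i′))))))

variable-bound : ∀ l → ∃[ b ] (∀ x → v x ∈ l → x < b)
variable-bound [] = 0 , λ _ ()
variable-bound (σ ∷ l) =
  let b , h = variable-bound l in
  -- Since `v x` has code `14 + x`, the sum of all codes exceeds every index that occurs.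
  symbolCode σ + b ,
  λ { x (here refl) → <-≤-trans (m<n+m x (s≤s z≤n)) (m≤m+n (14 + x) b)
    ; x (there q)   → <-≤-trans (h x q) (m≤n+m b (symbolCode σ)) }

varsBelow-mono : ∀ {i j} A → i ≤ j → VarsBelow i A → VarsBelow j A
varsBelow-mono A i≤j below x x∈ = <-≤-trans (below x x∈) i≤j

-- The variable replaced is d + j > 0, which is not free in a name.
names-lower : ∀ {T i j} d A → VarsBelow (d + j) A → ∣ A ∣ < j → Names T A i →
              ∃[ B ] (VarsBelow j B × ∣ B ∣ < j × Names T B i)
names-lower zero A below len nm = A , below , len , nm
names-lower {T} {i} {j} (suc d) A below len (atMost , thm) =
  let y , y<j , y∉ = unused-variable (symbols A) len
      x = d + j
      x≢0 = m<n⇒n≢0 (<-≤-trans y<j (m≤n+m j d))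
      x∉A = atMost x λ { (here x≡0) → x≢0 x≡0 }
      -- As `x` is not free in `A`, substituting for it does nothing, and `rename-α` relates `A`
      -- itself to its renaming.
      f , f′ = subst (_⟛[ T ] rename y x A) (subst-notFree A x∉A) (rename-α A (∉⇒fresh A y∉))
      thm′ = ∀E-self thm
  in names-lower d (rename y x A)
       (varsBelow-rename A (<-≤-trans y<j (m≤n+m j d)) below)
       (subst (_< j) (sym (length-rename x y A)) len)
       ( (λ z z∉ → notFree-rename A
            (subst (z NotFreeIn_) (sym (subst-notFree A x∉A)) (atMost z z∉)))
       , ∀I 0 [] (∧I (⇒I (⇒E (∧E₁ (theorem thm′)) (cut hyp₀ f′)))
                     (⇒I (cut (⇒E (∧E₂ (theorem thm′)) hyp₀) f))))

nameableBelow⇒𝓑 : ∀ {T g i j} → BoundsCodes g → NameableBelow T j i → 𝓑 T g i j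
nameableBelow⇒𝓑 {j = j} bounds (A , len , nm) =
  let b , h = variable-bound (symbols A)
      -- The bound `b` is weakened to `b + j`, from which `b` lowering steps lead to `j`.
      B , below , len′ , nm′ = names-lower b A (varsBelow-mono A (m≤m+n b j) h) len nm
  in B , bounds B j below len′ , len′ , nm′

𝓑⇒nameableBelow : ∀ {T g i j} → 𝓑 T g i j → NameableBelow T j i
𝓑⇒nameableBelow (A , _ , len , nm) = A , len , nm

-- Equality

-- An index from which on no variable occurs; it supplies the placeholder variable for rewriting
-- with an equation.
varBound : Term → ℕ
varBound (var x) = suc x
varBound zer     = 0
varBound (s a)   = varBound a
varBound (a ⊕ b) = varBound a ⊔ varBound b
varBound (a ⊗ b) = varBound a ⊔ varBound b

varBound-notIn : ∀ {x} a → varBound a ≤ x → x NotIn a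
varBound-notIn {x} (var y) p = ≢⇒notIn-var {x} (λ { refl → <-irrefl refl p })
varBound-notIn zer     p = refl
varBound-notIn (s a)   p = varBound-notIn a p
varBound-notIn (a ⊕ b) p = +≡0
  (varBound-notIn a (m⊔n≤o⇒m≤o (varBound a) _ p)) (varBound-notIn b (m⊔n≤o⇒n≤o (varBound a) _ p))
varBound-notIn (a ⊗ b) p = +≡0
  (varBound-notIn a (m⊔n≤o⇒m≤o (varBound a) _ p)) (varBound-notIn b (m⊔n≤o⇒n≤o (varBound a) _ p))

≐-leibniz : ∀ {T Γ a b} c d x → T ⨾ Γ ⊢ a ≐ b →
            T ⨾ Γ ⊢ (c [ a / x ]ₜ) ≐ (d [ a / x ]ₜ) → T ⨾ Γ ⊢ (c [ b / x ]ₜ) ≐ (d [ b / x ]ₜ)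
≐-leibniz c d x = ≐E (c ≐ d) x tt tt

≐-sym : ∀ {T Γ a b} → T ⨾ Γ ⊢ a ≐ b → T ⨾ Γ ⊢ b ≐ a
≐-sym {T} {Γ} {a} {b} p =
  subst (T ⨾ Γ ⊢_) (cong₂ _≐_ (substₜ-var x) (substₜ-notIn a x∉a))
    (≐-leibniz (var x) a x p
      (subst (T ⨾ Γ ⊢_) (sym (cong₂ _≐_ (substₜ-var x) (substₜ-notIn a x∉a))) (≐I a)))
  where
  x   = varBound a
  x∉a = varBound-notIn a ≤-refl

≐-trans : ∀ {T Γ a b c} → T ⨾ Γ ⊢ a ≐ b → T ⨾ Γ ⊢ b ≐ c → T ⨾ Γ ⊢ a ≐ c
≐-trans {T} {Γ} {a} p q =
  subst (T ⨾ Γ ⊢_) (cong₂ _≐_ (substₜ-notIn a x∉a) (substₜ-var x))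
    (≐-leibniz a (var x) x q
      (subst (T ⨾ Γ ⊢_) (sym (cong₂ _≐_ (substₜ-notIn a x∉a) (substₜ-var x))) p))
  where
  x   = varBound a
  x∉a = varBound-notIn a ≤-refl

-- Rewriting starts from reflexivity and changes only the right side: the left side no longer
-- contains `x`, because `a` does not.
≐-cong : ∀ {T Γ a b} c x → T ⨾ Γ ⊢ a ≐ b → x NotIn a → T ⨾ Γ ⊢ (c [ a / x ]ₜ) ≐ (c [ b / x ]ₜ)
≐-cong {T} {Γ} {a} {b} c x p x∉a =
  subst (λ d → T ⨾ Γ ⊢ d ≐ (c [ b / x ]ₜ)) (substₜ-notIn (c [ a / x ]ₜ) x∉)
    (≐-leibniz (c [ a / x ]ₜ) c x p
      (subst (λ d → T ⨾ Γ ⊢ d ≐ (c [ a / x ]ₜ)) (sym (substₜ-notIn (c [ a / x ]ₜ) x∉)) (≐I _)))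
  where
  x∉ : x NotIn (c [ a / x ]ₜ)
  x∉ = notIn-substₜ c (λ x≢x → ⊥-elim (x≢x refl)) x∉a

s-cong : ∀ {T Γ a b} → T ⨾ Γ ⊢ a ≐ b → T ⨾ Γ ⊢ s a ≐ s b
s-cong {T} {Γ} {a} {b} p =
  subst (T ⨾ Γ ⊢_) (cong₂ (λ c d → s c ≐ s d) (substₜ-var x) (substₜ-var x))
    (≐-cong (s (var x)) x p (varBound-notIn a ≤-refl))
  where x = varBound a

⊕-congˡ : ∀ {T Γ a b} i → T ⨾ Γ ⊢ a ≐ b → T ⨾ Γ ⊢ a ⊕ num i ≐ b ⊕ num i
⊕-congˡ {T} {Γ} {a} {b} i p =
  subst (T ⨾ Γ ⊢_)
    (cong₂ _≐_ (cong₂ _⊕_ (substₜ-var x) (substₜ-notIn (num i) (num-closed i x)))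
               (cong₂ _⊕_ (substₜ-var x) (substₜ-notIn (num i) (num-closed i x))))
    (≐-cong (var x ⊕ num i) x p (varBound-notIn a ≤-refl))
  where x = varBound a

-- Robinson arithmetic

num-subst : ∀ {x u} i → num i [ u / x ]ₜ ≡ num i
num-subst {x} i = substₜ-notIn (num i) (num-closed i x)

module _ {T : Theory} (Q⊢ : ExtendsQ T) where

  s≢zer : ∀ a → T ⊢ ~ (s a ≐ zer)
  s≢zer a = ∀E a tt (All.lookup Q⊢ (here refl))

  s-injective : ∀ i j → T ⊢ (s (num i) ≐ s (num j)) ⇒ (num i ≐ num j)
  s-injective i j =
    subst (λ a → T ⊢ (s a ≐ s (num j)) ⇒ (a ≐ num j)) (num-subst i)
      (∀E (num j) (tt , tt)
        (∀E (num i) (inj₂ (num-closed i 1 , tt , tt)) (All.lookup Q⊢ (there (here refl)))))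

  zer-or-s : ∀ x → x ≢ 1 → T ⊢ ~ (var x ≐ zer) ⇒ ∃' 1 (var x ≐ s (var 1))
  zer-or-s x x≢1 =
    ∀E (var x) (tt , inj₂ (≢⇒notIn-var {1} (λ 1≡x → x≢1 (sym 1≡x)) , tt))
      (All.lookup Q⊢ (there (there (here refl))))

  ⊕-zer : ∀ a → T ⊢ a ⊕ zer ≐ a
  ⊕-zer a = ∀E a tt (All.lookup Q⊢ (there (there (there (here refl)))))

  -- Passing through the variable 3 allows a to contain the variable 1, which
  -- is bound in the axiom.
  ⊕-s : ∀ a i → T ⊢ a ⊕ s (num i) ≐ s (a ⊕ num i)
  ⊕-s a i =
    subst (λ b → T ⊢ a ⊕ s b ≐ s (a ⊕ b)) (num-subst i)
      (∀E a tt (∀I 3 []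
        (∀E (num i) tt
          (∀E (var 3) (inj₂ (refl , tt)) (All.lookup Q⊢ (there (there (there (there (here refl))))))))))

  ≼-def : ∀ i b → 2 NotIn b → T ⊢ num i ≼ b ⇔' ∃' 2 (var 2 ⊕ num i ≐ b)
  ≼-def i b 2∉b =
    subst (λ a → T ⊢ a ≼ b ⇔' ∃' 2 (var 2 ⊕ a ≐ b)) (num-subst i)
      (∀E b ((tt , inj₂ (2∉b , tt)) , (inj₂ (2∉b , tt) , tt))
        (∀E (num i)
          (inj₂ (num-closed i 1 , (tt , inj₂ (num-closed i 2 , tt)) , (inj₂ (num-closed i 2 , tt) , tt)))
          (All.lookup Q⊢ (there (there (there (there (there (there (there (here refl)))))))))))

  ≼-intro : ∀ {Γ} a i b → 2 NotIn b → T ⨾ Γ ⊢ a ⊕ num i ≐ b → T ⨾ Γ ⊢ num i ≼ b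
  ≼-intro {Γ} a i b 2∉b p =
    ⇒E (∧E₂ (theorem (≼-def i b 2∉b)))
      (∃I a tt (subst (T ⨾ Γ ⊢_) (sym (cong₂ (λ c d → a ⊕ c ≐ d) (num-subst i) (substₜ-notIn b 2∉b))) p))

  zer-⊕ : ∀ i → T ⊢ zer ⊕ num i ≐ num i
  zer-⊕ zero    = ⊕-zer zer
  zer-⊕ (suc i) = ≐-trans (⊕-s zer i) (s-cong (zer-⊕ i))

  -- The second summand is a numeral, so the induction runs outside `T`; `Q` could not prove this
  -- for a variable there.
  s-⊕ : ∀ a i → T ⊢ s a ⊕ num i ≐ a ⊕ s (num i)
  s-⊕ a zero    = ≐-trans (⊕-zer (s a)) (≐-sym (≐-trans (⊕-s a 0) (s-cong (⊕-zer a))))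
  s-⊕ a (suc i) = ≐-trans (⊕-s (s a) i) (≐-trans (s-cong (s-⊕ a i)) (≐-sym (⊕-s a (suc i))))

  -- The sum is written `j + i` so that it unfolds along the recursion of addition in `Q` on its
  -- second argument.
  num-⊕ : ∀ i j → T ⊢ num i ⊕ num j ≐ num (j + i)
  num-⊕ i zero    = ⊕-zer (num i)
  num-⊕ i (suc j) = ≐-trans (⊕-s (num i) j) (s-cong (num-⊕ i j))

  num-≢ : ∀ {i j} → i < j → T ⊢ ~ (num i ≐ num j)
  num-≢ {zero}  {suc j} _         = ~I (≐-sym hyp₀) (theorem (s≢zer (num j)))
  num-≢ {suc i} {suc j} (s≤s i<j) =
    ~I (⇒E (theorem (s-injective i j)) hyp₀) (theorem (num-≢ i<j))

  num-≼ : ∀ i d → T ⊢ num i ≼ num (i + d)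
  num-≼ i d = ≼-intro (num d) i (num (i + d)) (num-closed (i + d) 2) (num-⊕ d i)

  num-≺ : ∀ {i j} → i < j → T ⊢ num i ≺ num j
  num-≺ {i} {j} i<j =
    ∧I (subst (λ k → T ⊢ num i ≼ num k) (m+[n∸m]≡n (<⇒≤ i<j)) (num-≼ i (j ∸ i))) (num-≢ i<j)

  ≼-zer : T ⊢ zer ≼ var 0
  ≼-zer = ≼-intro (var 0) 0 (var 0) refl (⊕-zer (var 0))

  -- Let z + i = v₀. If z is 0, then v₀ is i; if z is the successor of w, then w + s(i) = v₀, so w
  -- witnesses the larger bound. Here z is v₂ and w is v₁.
  ≼-step : ∀ i → T ⨾ num i ≼ var 0 ∷ [] ⊢ num i ≐ var 0 ∨' num (suc i) ≼ var 0
  ≼-step i =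
    ∃E {x = 2} (+≡0 (num-closed i 2) refl ∷ [])
      (+≡0 (+≡0 (num-closed i 2) refl) (+≡0 (num-closed i 2) refl))
      (⇒E (∧E₁ (theorem (≼-def i (var 0) refl))) hyp₀)
      (byCases (var 2 ≐ zer)
        (∨I₁ (≐-trans (≐-sym (theorem (zer-⊕ i))) (≐-trans (⊕-congˡ i (≐-sym hyp₀)) hyp₁)))
        (∃E {x = 1}
          (refl ∷ +≡0 (num-closed i 1) refl ∷ +≡0 (num-closed i 1) refl ∷ [])
          (+≡0 (+≡0 (num-closed i 1) refl) (+≡0 (num-closed i 1) refl))
          (⇒E (theorem (zer-or-s 2 λ ())) hyp₀)
          (∨I₂ (≼-intro (var 1) (suc i) (var 0) refl
            (≐-trans (≐-sym (theorem (s-⊕ (var 1) i)))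
              (≐-trans (⊕-congˡ i (≐-sym hyp₀)) (hyp (there (there (here refl))))))))))

  -- Starting from 0 ≤ v₀, each use of `≼-step` either settles v₀ as a numeral or raises the lower
  -- bound by one.
  numeral-cases : ∀ n {Γ C} → (∀ {i} → i < n → T ⨾ var 0 ≐ num i ∷ Γ ⊢ C) →
                  T ⨾ num n ≼ var 0 ∷ Γ ⊢ C → T ⨾ Γ ⊢ C
  numeral-cases zero    below above = ⇒E (⇒I above) (theorem ≼-zer)
  numeral-cases (suc n) below above =
    numeral-cases n (λ i<n → below (m<n⇒m<1+n i<n))
      (∨E (cut hyp₀ (≼-step n))
        (⇒E (wk (wk (⇒I (below (n<1+n n))))) (≐-sym hyp₀))
        (⇒E (wk (wk (⇒I above))) hyp₀))

-- Numbers named by ψ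

-- `B` stands for φ(v₀,t). `FreeFor` is what makes instances of the bounded quantifier in `ψ B`
-- instances of `B`.
ψ-names : ∀ {T} → ExtendsQ T → ∀ B n → AtMostFree (0 ∷ []) B → FreeFor (var 2) 0 B →
          T ⊢ ψ B [ num n / 0 ] → Names T (ψ B) n
ψ-names {T} Q⊢ B n atMost f d = atMost-ψ , ∀I 0 [] (∧I (⇒I least) (⇒I equal))
  where
  B₂ = B [ var 2 / 0 ]

  2∉B : 2 NotFreeIn B
  2∉B = atMost 2 λ { (here ()) ; (there ()) }

  0∉B₂ : 0 NotFreeIn B₂
  0∉B₂ = notFree-subst B (λ 0≢0 → ⊥-elim (0≢0 refl)) refl

  d′ : T ⊢ (~ (B [ num n / 0 ])) ∧' ∀< 2 (num n) B₂
  -- In the second conjunct only the bound is affected by the numeral, since v₀ is no longer free in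
  -- `B₂`.
  d′ = subst (λ C → T ⊢ (~ (B [ num n / 0 ])) ∧' ∀< 2 (num n) C) (subst-notFree B₂ 0∉B₂) d

  atMost-ψ : AtMostFree (0 ∷ []) (ψ B)
  atMost-ψ x x∉ = +≡0 (atMost x x∉) below
    where
    x≢0 : x ≢ 0
    x≢0 e = x∉ (here e)
    below : x NotFreeIn ∀< 2 (var 0) B₂
    below with x ≟ 2
    ... | yes refl = refl
    ... | no x≢2   = notFree-∀⁺ {A = (var 2 ≺ var 0) ⇒ B₂} 2
      (+≡0 (+≡0 (+≡0 x∉2 x∉0) (+≡0 x∉2 x∉0)) (notFree-subst B (λ _ → atMost x x∉) x∉2))
      where
      x∉2 = ≢⇒notIn-var {x} {2} x≢2
      x∉0 = ≢⇒notIn-var {x} {0} x≢0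

  -- The bound `a` is the numeral n when the given theorem is used, and v₀ when the assumption `ψ B`
  -- is used.
  instantiate : ∀ {Γ a} i → T ⨾ Γ ⊢ ∀< 2 a B₂ → 2 NotIn a → T ⨾ Γ ⊢ num i ≺ a → T ⨾ Γ ⊢ B [ num i / 0 ]
  instantiate {Γ} {a} i e 2∉a i≺a =
    ⇒E (subst (T ⨾ Γ ⊢_)
         (cong₂ (λ b C → (num i ≺ b) ⇒ C) (substₜ-notIn a 2∉a) (subst-trans B 2∉B f))
         (∀E (num i) (freeFor-closed ((var 2 ≺ a) ⇒ B₂) (num-closed i)) e))
       i≺a

  at-var : ∀ {Γ} A i → T ⨾ Γ ⊢ var 0 ≐ num i → T ⨾ Γ ⊢ A [ num i / 0 ] → T ⨾ Γ ⊢ A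
  at-var {Γ} A i p q = subst (T ⨾ Γ ⊢_) (subst-self 0 A)
    (≐E A 0 (freeFor-closed A (num-closed i)) (freeFor-self 0 A) (≐-sym p) q)

  equal : T ⨾ var 0 ≐ num n ∷ [] ⊢ ψ B
  equal = at-var (ψ B) n hyp₀ (theorem d)

  least : T ⨾ ψ B ∷ [] ⊢ var 0 ≐ num n
  least = numeral-cases Q⊢ n
    (λ {i} i<n → explode
      (at-var B i hyp₀ (instantiate i (theorem (∧E₂ d′)) (num-closed n 2) (theorem (num-≺ Q⊢ i<n))))
      (∧E₁ hyp₁))
    -- The equation is oriented as in `num n ≺ var 0`, whose second conjunct is then the hypothesis
    -- of the other case.
    (byCases (num n ≐ var 0)
      (≐-sym hyp₀)
      (explode
        (instantiate n (∧E₂ (hyp (there (there (here refl))))) refl (∧I hyp₁ hyp₀))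
        (theorem (∧E₁ d′))))

-- Length

length-infix : ∀ {A : Set} (as bs : List A) {m r} →
               length (as ++ m ∷ bs ++ r ∷ []) ≡ 2 + (length as + length bs)
length-infix as bs =
  trans (length-++ as) (trans (cong (λ j → length as + suc j) (length-++ bs))
        (arith (length as) (length bs)))
  where
  arith : ∀ a b → a + suc (b + 1) ≡ 2 + (a + b)
  arith = solve-∀

length-infix′ : ∀ {A : Set} (as bs : List A) {m} →
                length (as ++ m ∷ bs) ≡ 1 + (length as + length bs)
length-infix′ as bs = trans (length-++ as) (+-suc (length as) (length bs))

+-mono-subst : ∀ c {a a′ b b′} p q ℓ → a′ ≤ a + p * ℓ → b′ ≤ b + q * ℓ →
               c + (a′ + b′) ≤ c + (a + b) + (p + q) * ℓ
+-mono-subst c {a} {a′} {b} {b′} p q ℓ h h′ = begin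
  c + (a′ + b′)                     ≤⟨ +-monoʳ-≤ c (+-mono-≤ h h′) ⟩
  c + ((a + p * ℓ) + (b + q * ℓ))   ≡⟨ arith c a b p q ℓ ⟩
  c + (a + b) + (p + q) * ℓ         ∎
  where
  open ≤-Reasoning
  arith : ∀ c a b p q ℓ → c + ((a + p * ℓ) + (b + q * ℓ)) ≡ c + (a + b) + (p + q) * ℓ
  arith = solve-∀

∣_∣ₜ : Term → ℕ
∣ a ∣ₜ = length (termSymbols a)

infix-subst : ∀ {A : Set} (as as′ bs bs′ : List A) {m r} p q ℓ →
              length as′ ≤ length as + p * ℓ → length bs′ ≤ length bs + q * ℓ →
              length (as′ ++ m ∷ bs′ ++ r ∷ []) ≤
              length (as ++ m ∷ bs ++ r ∷ []) + (p + q) * ℓ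
infix-subst as as′ bs bs′ {m} {r} p q ℓ h h′ =
  subst₂ (λ i j → i ≤ j + (p + q) * ℓ)
    (sym (length-infix as′ bs′ {m} {r})) (sym (length-infix as bs {m} {r}))
    (+-mono-subst 2 p q ℓ h h′)

infix-subst′ : ∀ {A : Set} (as as′ bs bs′ : List A) {m} p q ℓ →
               length as′ ≤ length as + p * ℓ → length bs′ ≤ length bs + q * ℓ →
               length (as′ ++ m ∷ bs′) ≤ length (as ++ m ∷ bs) + (p + q) * ℓ
infix-subst′ as as′ bs bs′ {m} p q ℓ h h′ =
  subst₂ (λ i j → i ≤ j + (p + q) * ℓ)
    (sym (length-infix′ as′ bs′ {m})) (sym (length-infix′ as bs {m})) (+-mono-subst 1 p q ℓ h h′)

-- Only an upper bound: each replaced variable symbol is still counted on the right.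
length-substₜ : ∀ x u a → ∣ a [ u / x ]ₜ ∣ₜ ≤ ∣ a ∣ₜ + occ x a * ∣ u ∣ₜ
length-substₜ x u (var y) with x ≡ᵇ y
... | true  = ≤-trans (≤-reflexive (sym (+-identityʳ ∣ u ∣ₜ))) (n≤1+n _)
... | false = ≤-refl
length-substₜ x u zer     = ≤-refl
length-substₜ x u (s a)   = s≤s (length-substₜ x u a)
length-substₜ x u (a ⊕ b) =
  s≤s (infix-subst (termSymbols a) (termSymbols (a [ u / x ]ₜ)) (termSymbols b) (termSymbols (b [ u / x ]ₜ))
    (occ x a) (occ x b) ∣ u ∣ₜ
    (length-substₜ x u a) (length-substₜ x u b))
length-substₜ x u (a ⊗ b) =
  s≤s (infix-subst (termSymbols a) (termSymbols (a [ u / x ]ₜ)) (termSymbols b) (termSymbols (b [ u / x ]ₜ))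
    (occ x a) (occ x b) ∣ u ∣ₜ
    (length-substₜ x u a) (length-substₜ x u b))

length-subst : ∀ x u A → ∣ A [ u / x ] ∣ ≤ ∣ A ∣ + freeOcc x A * ∣ u ∣ₜ
length-subst x u (a ≐ b)  =
  infix-subst′ (termSymbols a) (termSymbols (a [ u / x ]ₜ)) (termSymbols b) (termSymbols (b [ u / x ]ₜ))
    (occ x a) (occ x b) ∣ u ∣ₜ
    (length-substₜ x u a) (length-substₜ x u b)
length-subst x u (a ≼ b)  =
  infix-subst′ (termSymbols a) (termSymbols (a [ u / x ]ₜ)) (termSymbols b) (termSymbols (b [ u / x ]ₜ))
    (occ x a) (occ x b) ∣ u ∣ₜ
    (length-substₜ x u a) (length-substₜ x u b)
length-subst x u (~ A)    = s≤s (length-subst x u A)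
length-subst x u (A ∧' B) =
  s≤s (infix-subst (symbols A) (symbols (A [ u / x ])) (symbols B) (symbols (B [ u / x ]))
    (freeOcc x A) (freeOcc x B) ∣ u ∣ₜ
    (length-subst x u A) (length-subst x u B))
length-subst x u (A ∨' B) =
  s≤s (infix-subst (symbols A) (symbols (A [ u / x ])) (symbols B) (symbols (B [ u / x ]))
    (freeOcc x A) (freeOcc x B) ∣ u ∣ₜ
    (length-subst x u A) (length-subst x u B))
length-subst x u (A ⇒ B)  =
  s≤s (infix-subst (symbols A) (symbols (A [ u / x ])) (symbols B) (symbols (B [ u / x ]))
    (freeOcc x A) (freeOcc x B) ∣ u ∣ₜ
    (length-subst x u A) (length-subst x u B))
length-subst x u (∀' y A) with x ≡ᵇ y
... | true  = m≤m+n _ 0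
... | false = s≤s (s≤s (s≤s (s≤s (length-subst x u A))))
length-subst x u (∃' y A) with x ≡ᵇ y
... | true  = m≤m+n _ 0
... | false = s≤s (s≤s (s≤s (s≤s (length-subst x u A))))

length-num : ∀ i → ∣ num i ∣ₜ ≡ suc i
length-num zero    = refl
length-num (suc i) = cong suc (length-num i)

length-tTerm : ∀ k → ∣ tTerm k ∣ₜ ≡ 2 * k + 19
length-tTerm k =
  trans (cong suc (length-infix (termSymbols (num 10)) (termSymbols (num k ⊗ num k)) {times} {rpar}))
    -- The 15 consists of 11 symbols of the numeral 10, three of the outer product, and the inner
    -- left parenthesis.
    (trans (cong (15 +_) (length-infix (termSymbols (num k)) (termSymbols (num k))))
      (trans (cong (λ j → 15 + (2 + (j + j))) (length-num k)) (arith k)))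
  where
  arith : ∀ k → 15 + (2 + (suc k + suc k)) ≡ 2 * k + 19
  arith = solve-∀

tTerm-closed : ∀ k → Closed (tTerm k)
tTerm-closed k x = +≡0 (num-closed 10 x) (+≡0 (num-closed k x) (num-closed k x))

⟦tTerm⟧ : ∀ {ρ} k → ⟦ tTerm k ⟧ ρ ≡ tValue k
⟦tTerm⟧ k = cong (10 *_) (cong₂ _*_ (⟦num⟧ k) (⟦num⟧ k))

-- The outer parentheses and the conjunction sign already make three symbols; this yields k ≥ 3 in
-- `length-bound`.
length-ψ : ∀ A → 3 ≤ ∣ ψ A ∣
length-ψ A = s≤s (≤-trans (m≤m+n 2 _)
  (≤-reflexive (sym (length-infix (symbols (~ A)) (symbols (∀< 2 (var 0) (A [ var 2 / 0 ])))))))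

length-bound : ∀ {k₁ k₂ m} → 3 ≤ k₁ → m < k₂ →
               k₁ + m * (2 * (k₁ * k₂) + 19) < tValue (k₁ * k₂)
length-bound {k₁} {k₂} {m} 3≤k₁ m<k₂ = begin-strict
  k₁ + m * (2 * k + 19)     ≤⟨ +-mono-≤ k₁≤k (*-monoˡ-≤ (2 * k + 19) m≤k) ⟩
  k + k * (2 * k + 19)      ≡⟨ arith₁ k ⟩
  -- The linear coefficient is raised to 24 = 8 · 3, so that k ≥ 3 turns the linear term into 8k²;
  -- strictness uses k > 0.
  2 * (k * k) + 20 * k      <⟨ +-monoʳ-< (2 * (k * k)) (*-monoˡ-< k (m≤m+n 21 3)) ⟩
  2 * (k * k) + 24 * k      ≡⟨ arith₂ k ⟩
  2 * (k * k) + 8 * (k * 3) ≤⟨ +-monoʳ-≤ (2 * (k * k)) (*-monoʳ-≤ 8 (*-monoʳ-≤ k 3≤k)) ⟩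
  2 * (k * k) + 8 * (k * k) ≡⟨ arith₃ k ⟩
  10 * (k * k)              ∎
  where
  open ≤-Reasoning
  k = k₁ * k₂
  instance
    k₁≢0 = >-nonZero (≤-trans (s≤s z≤n) 3≤k₁)
    k₂≢0 = >-nonZero (≤-trans (s≤s z≤n) m<k₂)
  k₁≤k : k₁ ≤ k
  k₁≤k = m≤m*n k₁ k₂
  3≤k : 3 ≤ k
  3≤k = ≤-trans 3≤k₁ k₁≤k
  m≤k : m ≤ k
  m≤k = ≤-trans (<⇒≤ m<k₂) (m≤n*m k₂ k₁)
  instance
    k≢0 = >-nonZero (≤-trans (s≤s z≤n) 3≤k)
  arith₁ : ∀ k → k + k * (2 * k + 19) ≡ 2 * (k * k) + 20 * k
  arith₁ = solve-∀
  arith₂ : ∀ k → 2 * (k * k) + 24 * k ≡ 2 * (k * k) + 8 * (k * 3)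
  arith₂ = solve-∀
  arith₃ : ∀ k → 2 * (k * k) + 8 * (k * k) ≡ 10 * (k * k)
  arith₃ = solve-∀

-- Substituting a closed term for the parameter of ψ

ψ-subst₁ : ∀ φ {u} → Closed u → ψ φ [ u / 1 ] ≡ ψ (φ [ u / 1 ])
-- Only the copy of φ with v₂ for v₀ needs an argument: `u` is closed and v₂ is not v₁, so the two
-- substitutions commute.
ψ-subst₁ φ {u} c = cong (λ C → (~ (φ [ u / 1 ])) ∧' ∀< 2 (var 0) C) (subst-comm {0} {1} (λ ()) refl (c 0) φ)

-- A closed term adds neither binders nor occurrences of `x`.
freeFor-substClosed : ∀ {w u} x y A → Closed u → FreeFor w x A → FreeFor w x (A [ u / y ])
freeFor-substClosed x y (a ≐ b)  c f = tt
freeFor-substClosed x y (a ≼ b)  c f = tt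
freeFor-substClosed x y (~ A)    c f = freeFor-substClosed x y A c f
freeFor-substClosed x y (A ∧' B) c (f , g) = freeFor-substClosed x y A c f , freeFor-substClosed x y B c g
freeFor-substClosed x y (A ∨' B) c (f , g) = freeFor-substClosed x y A c f , freeFor-substClosed x y B c g
freeFor-substClosed x y (A ⇒ B)  c (f , g) = freeFor-substClosed x y A c f , freeFor-substClosed x y B c g
freeFor-substClosed {u = u} x y (∀' z A) c (inj₁ p)
  with y ≡ᵇ z | notFree-subst {y} {u} {x} (∀' z A) (λ _ → p) (c x)
... | true  | _ = inj₁ p
... | false | q = inj₁ q
freeFor-substClosed x y (∀' z A) c (inj₂ (p , f)) with y ≡ᵇ z
... | true  = inj₂ (p , f)
... | false = inj₂ (p , freeFor-substClosed x y A c f)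
freeFor-substClosed {u = u} x y (∃' z A) c (inj₁ p)
  with y ≡ᵇ z | notFree-subst {y} {u} {x} (∃' z A) (λ _ → p) (c x)
... | true  | _ = inj₁ p
... | false | q = inj₁ q
freeFor-substClosed x y (∃' z A) c (inj₂ (p , f)) with y ≡ᵇ z
... | true  = inj₂ (p , f)
... | false = inj₂ (p , freeFor-substClosed x y A c f)

atMostFree-subst₁ : ∀ {φ u} → Closed u → AtMostFree (0 ∷ 1 ∷ []) φ → AtMostFree (0 ∷ []) (φ [ u / 1 ])
atMostFree-subst₁ {φ} c h x x∉ = notFree-subst φ
  (λ x≢1 → h x λ { (here e) → x∉ (here e) ; (there (here e)) → x≢1 e })
  (c x)

mainTheorem1 : (T : Theory) → Consistent T → ExtendsQ T → Definable (Pr T) →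
    (g : ℕ → ℕ) → Recursive g → BoundsCodes g →
    (φ : Formula) → Defines₂ φ (𝓑 T g) →
    (RecursivelyAxiomatizable T → Σ₁ φ) → FreeFor (var 2) 0 φ →
    (k₂ : ℕ) → freeOcc 1 (ψ φ) < k₂ →
    let k = kOf φ k₂
        t = tTerm k
        𝐭 = tValue k
    in
    (n : ℕ) → ¬ NameableBelow T 𝐭 n →
    (∀ m → m < n → NameableBelow T 𝐭 m) →
    (ω⊨ ψ φ ⟨ num n , t ⟩) × (¬ (T ⊢ ψ φ ⟨ num n , t ⟩))
mainTheorem1 T _ Q⊢ _ g _ bounds φ (atMost , defines) _ f k₂ occ<k₂ n ¬nameable nameable =
  true-in-ω , λ d → ¬nameable (ψ φ [ t / 1 ] , short , names d)
  where
  k = kOf φ k₂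
  t = tTerm k
  t-closed = tTerm-closed k

  true-in-ω : ω⊨ ψ φ ⟨ num n , t ⟩
  true-in-ω ρ =
    from (⊨-subst (ψ φ [ num n / 0 ]) (freeFor-closed (ψ φ [ num n / 0 ]) t-closed))
      (from (⊨-subst (ψ φ) (freeFor-closed (ψ φ) (num-closed n))) (not-at-n , below-n))
    where
    -- The update at v₁ comes first because the substitution of t is the outer one.
    ρ′ = ρ [ 1 ↦ ⟦ t ⟧ ρ ] [ 0 ↦ ⟦ num n ⟧ (ρ [ 1 ↦ ⟦ t ⟧ ρ ]) ]
    not-at-n : ¬ (ρ′ ⊨ φ)
    not-at-n p = ¬nameable (𝓑⇒nameableBelow {g = g}
      (subst₂ (𝓑 T g) (⟦num⟧ n) (⟦tTerm⟧ k) (to (defines ρ′) p)))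
    below-n : ρ′ ⊨ ∀< 2 (var 0) (φ [ var 2 / 0 ])
    -- After v₂ receives a, putting v₂ for v₀ makes `defines` speak of the pair of a and the value
    -- of t; leastness of n makes a nameable.
    below-n a (a≤n , a≢n) = from (⊨-subst φ f) (from (defines _)
      (subst (𝓑 T g a) (sym (⟦tTerm⟧ k))
        (nameableBelow⇒𝓑 bounds (nameable a (subst (a <_) (⟦num⟧ n) (≤∧≢⇒< a≤n a≢n))))))

  short : ∣ ψ φ [ t / 1 ] ∣ < tValue k
  short = ≤-<-trans
    (subst (λ ℓ → ∣ ψ φ [ t / 1 ] ∣ ≤ ∣ ψ φ ∣ + freeOcc 1 (ψ φ) * ℓ) (length-tTerm k) (length-subst 1 t (ψ φ)))
    (length-bound (length-ψ φ) occ<k₂)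

  names : T ⊢ ψ φ ⟨ num n , t ⟩ → Names T (ψ φ [ t / 1 ]) n
  names d = subst (λ A → Names T A n) (sym (ψ-subst₁ φ t-closed))
    (ψ-names Q⊢ (φ [ t / 1 ]) n (atMostFree-subst₁ {φ} t-closed atMost) (freeFor-substClosed 0 1 φ t-closed f)
      (subst (T ⊢_)
        -- The sentence inserts the numeral first and t second; `ψ-names` needs the reverse order.
        (trans (subst-comm {0} {1} (λ ()) (num-closed n 1) (t-closed 0) (ψ φ))
               (cong _[ num n / 0 ] (ψ-subst₁ φ t-closed)))
        d))
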